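{- Let $N$ be a positive integer, $k$ a nonnegative integer, $n\ge 2$ an integer, and $x$ a real or complex variable. Then $$\Psi_k^N(x,n)=\frac{k!\,N!}{(k+N)!}\sum_{j=0}^{k}\binom{k+N}{j}M_j^N(n)\,S(k+N-j,N)\,x^{k+N-j},$$ where $S(\ell,m)$ denotes the Stirling numbers of the second kind.
   Context: Let $\mu$ be the Möbius function. For a positive integer $n$ and a real or complex variable $x$, the Möbius–Bernoulli power sums $\Psi_k(x,n)$, $k=0,1,2,\dots$, are defined by the generating function $$\sum_{d\mid n}\mu(d)\frac{e^{\left(1+\frac{x}{d}\right)td}-e^{td}}{e^{td}-1}=\sum_{k=0}^{\infty}\Psi_k(x,n)\frac{t^k}{k!},$$ and their sums of products are $$\Psi_k^N(x,n):=\sum_{k_1+\cdots+k_N=k}\binom{k}{k_1,\dots,k_N}\Psi_{k_1}(x,n)\cdots\Psi_{k_N}(x,n),$$ the sum being over ordered $N$-tuples of nonnegative integers, with $\binom{k}{k_1,\dots,k_N}=\frac{k!}{k_1!\cdots k_N!}$; equivalently $\left(\sum_{d\mid n}\mu(d)\frac{e^{(1+x/d)td}-e^{td}}{e^{td}-1}\right)^N=\sum_{k\ge0}\Psi_k^N(x,n)\frac{t^k}{k!}$. The Möbius–Bernoulli numbers $M_k(n)$ are defined by $$\sum_{d\mid n}\frac{t\,\mu(d)}{e^{td}-1}=\sum_{k=0}^{\infty}M_k(n)\frac{t^k}{k!},\qquad |t|<\frac{2\pi}{n},$$ and the higher order Möbius–Bernoulli numbers by $$M_k^N(n):=\sum_{k_1+\cdots+k_N=k}\binom{k}{k_1,\dots,k_N}M_{k_1}(n)\cdots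 M_{k_N}(n)$$ (sum over ordered $N$-tuples of nonnegative integers); equivalently $\left(\sum_{d\mid n}\frac{t\mu(d)}{e^{td}-1}\right)^N=\sum_{k\ge0}M_k^N(n)\frac{t^k}{k!}$ for $|t|<2\pi/n$. In all generating functions the left side is extended by continuity to $t=0$. -}

module Defs where

open import Algebra.Bundles using (CommutativeRing)
open import Algebra.Morphism.Structures using (module RingMorphisms)
open import Data.Bool.Base using (if_then_else_)
open import Data.Fin.Base using (toℕ)
open import Data.Integer.Base as ℤ using (ℤ; +_; -1ℤ; 0ℤ)
open import Data.List.Base as List using (List; []; _∷_; length; concatMap; upTo)
open import Data.List.Relation.Unary.Unique.DecPropositional using (unique?)
open import Data.Nat.Base as ℕ using (ℕ; zero; suc; _∸_; _!; NonZero)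
open import Data.Nat.Divisibility using (_∣?_)
open import Data.Nat.Primality.Factorisation using (factorise; factors)
open import Data.Nat.Properties using (_≟_; _!≢0; m*n≢0)
open import Data.Rational.Base as ℚ using (ℚ)
open import Data.Vec.Base as Vec using (Vec; []; _∷_)
open import Level using (Level; _⊔_) renaming (suc to lsuc)
open import Relation.Nullary.Decidable.Core using (⌊_⌋)

import Algebra.Properties.Semiring.Exp as Exp
import Algebra.Properties.Semiring.Sum as Sum
import Relation.Binary.Reasoning.Setoid as ≈-Reasoning

-- (-1)^r for a product of r distinct primes, 0 if a prime factor is repeated.
μ : (d : ℕ) → .{{NonZero d}} → ℤ
μ d = let ps = factors (factorise d)
      in if ⌊ unique? _≟_ ps ⌋ then -1ℤ ℤ.^ length ps else 0ℤ

-- Stirling numbers of the second kind.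
S : ℕ → ℕ → ℕ
S zero    zero    = 1
S zero    (suc m) = 0
S (suc l) zero    = 0
S (suc l) (suc m) = suc m ℕ.* S l (suc m) ℕ.+ S l m

-- All ordered N-tuples of natural numbers with sum k, each listed once.
tuples : (N k : ℕ) → List (Vec ℕ N)
tuples zero    zero    = [] ∷ []
tuples zero    (suc k) = []
tuples (suc N) k       =
  concatMap (λ i → List.map (i ∷_) (tuples N (k ∸ i))) (upTo (suc k))

∏! : ∀ {N} → Vec ℕ N → ℕ
∏! []       = 1
∏! (i ∷ is) = i ! ℕ.* ∏! is

∏!≢0 : ∀ {N} (is : Vec ℕ N) → NonZero (∏! is)
∏!≢0 []       = _
∏!≢0 (i ∷ is) = m*n≢0 (i !) (∏! is) {{i !≢0}} {{∏!≢0 is}}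

multinomial : ∀ {N} → ℕ → Vec ℕ N → ℚ
multinomial k is = ((+ (k !)) ℚ./ ∏! is) {{∏!≢0 is}}

-- A commutative ring with rational scalars.  The real numbers, the
-- complex numbers and the polynomial ring ℚ[x] are instances, so a "real or
-- complex variable" is an arbitrary element of such an algebra.
record ℚ-Algebra (c ℓ : Level) : Set (lsuc (c ⊔ ℓ)) where
  field
    commutativeRing : CommutativeRing c ℓ

  open CommutativeRing commutativeRing public
  open RingMorphisms ℚ.+-*-rawRing rawRing using (IsRingHomomorphism)

  field
    ι                    : ℚ → Carrier
    ι-isRingHomomorphism : IsRingHomomorphism ι

module MöbiusBernoulli {c ℓ : Level} (A : ℚ-Algebra c ℓ) where

  open ℚ-Algebra A public hiding (zero)
  open Exp semiring public using (_^_)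
  open Sum semiring public using (sum-syntax; sum⁺-syntax)

  fromℕ : ℕ → Carrier
  fromℕ m = ι (+ m ℚ./ 1)

  fromℤ : ℤ → Carrier
  fromℤ z = ι (z ℚ./ 1)

  1/_ : (d : ℕ) → .{{NonZero d}} → Carrier
  1/ d = ι (+ 1 ℚ./ d)

  1/[_!] : ℕ → Carrier
  1/[ k !] = (1/ (k !)) {{k !≢0}}

  ∑∣ : (n : ℕ) → ((d : ℕ) → .{{NonZero d}} → Carrier) → Carrier
  ∑∣ n f = ∑[ i < n ] (if ⌊ suc (toℕ i) ∣? n ⌋ then f (suc (toℕ i)) else 0#)

  -- Generating functions are formal power series in t, given by their
  -- coefficients: F k is the coefficient of t^k (without the factor 1/k!).
  Series : Set c
  Series = ℕ → Carrier

  1ₛ : Series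
  1ₛ zero    = 1#
  1ₛ (suc _) = 0#

  t : Series
  t zero          = 0#
  t (suc zero)    = 1#
  t (suc (suc _)) = 0#

  infixl 6 _-ₛ_
  infixr 7 _·ₛ_

  _-ₛ_ : Series → Series → Series
  (F -ₛ G) k = F k - G k

  _·ₛ_ : Carrier → Series → Series
  (a ·ₛ F) k = a * F k

  -- The series exp (a · t).
  exp[_t] : Carrier → Series
  exp[ a t] k = a ^ k * 1/[ k !]

  -- Division by t of a series with zero constant coefficient.
  shift : Series → Series
  shift F k = F (suc k)

  -- Long division of F by G, where u is the inverse of the constant
  -- coefficient of G: the constant coefficient of the quotient is q = u · F₀,
  -- and the rest of it is the quotient of (F - q G) / t by G.
  divide : (u : Carrier) → Series → Series → Series
  divide u F G zero    = u * F zero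
  divide u F G (suc k) = divide u (shift (F -ₛ (u * F zero) ·ₛ G)) G k

  infixl 7 _*ₛ_

  _*ₛ_ : Series → Series → Series
  (F *ₛ G) k = ∑[ i ≤ k ] (F (toℕ i) * G (k ∸ toℕ i))

  divide-correct : ∀ u F G → u * G 0 ≈ 1# → ∀ k → (divide u F G *ₛ G) k ≈ F k
  divide-correct u F G uG₀≈1 zero = trans (+-identityʳ _) (begin
    u * F 0 * G 0    ≈⟨ *-congʳ (*-comm _ _) ⟩
    F 0 * u * G 0    ≈⟨ *-assoc _ _ _ ⟩
    F 0 * (u * G 0)  ≈⟨ *-congˡ uG₀≈1 ⟩
    F 0 * 1#         ≈⟨ *-identityʳ _ ⟩
    F 0              ∎)
    where open ≈-Reasoning setoid
  divide-correct u F G uG₀≈1 (suc k) = begin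
    q + (divide u F′ G *ₛ G) k  ≈⟨ +-congˡ (divide-correct u F′ G uG₀≈1 k) ⟩
    q + (F (suc k) - q)         ≈⟨ +-comm _ _ ⟩
    (F (suc k) - q) + q         ≈⟨ +-assoc _ _ _ ⟩
    F (suc k) + (- q + q)       ≈⟨ +-congˡ (-‿inverseˡ _) ⟩
    F (suc k) + 0#              ≈⟨ +-identityʳ _ ⟩
    F (suc k)                   ∎
    where
    open ≈-Reasoning setoid
    q  = u * F 0 * G (suc k)
    F′ = shift (F -ₛ (u * F 0) ·ₛ G)

  -- F / (exp (d t) - 1) for F with zero constant coefficient.  Numerator and
  -- denominator are divisible by t; cancelling t is what the extension by
  -- continuity to t = 0 amounts to.  The denominator then has constant
  -- coefficient d.
  infixl 7 _/exp[_t]-1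

  _/exp[_t]-1 : Series → (d : ℕ) → .{{NonZero d}} → Series
  F /exp[ d t]-1 = divide (1/ d) (shift F) (shift (exp[ fromℕ d t] -ₛ 1ₛ))

  Ψ-series : Carrier → ℕ → Series
  Ψ-series x n k = ∑∣ n λ d →
    (fromℤ (μ d) ·ₛ
      ((exp[ (1# + x * 1/ d) * fromℕ d t] -ₛ exp[ fromℕ d t]) /exp[ d t]-1)) k

  Ψ : ℕ → Carrier → ℕ → Carrier
  Ψ k x n = fromℕ (k !) * Ψ-series x n k

  M-series : ℕ → Series
  M-series n k = ∑∣ n λ d → ((fromℤ (μ d) ·ₛ t) /exp[ d t]-1) k

  M : ℕ → ℕ → Carrier
  M k n = fromℕ (k !) * M-series n k

  sumOfProducts : (N : ℕ) → (ℕ → Carrier) → ℕ → Carrier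
  sumOfProducts N a k = List.foldr _+_ 0# (List.map term (tuples N k))
    where
    term : Vec ℕ N → Carrier
    term is = ι (multinomial k is) * Vec.foldr′ _*_ 1# (Vec.map a is)

  Ψ^ : (N k : ℕ) → Carrier → ℕ → Carrier
  Ψ^ N k x n = sumOfProducts N (λ i → Ψ i x n) k

  M^ : (N k : ℕ) → ℕ → Carrier
  M^ N k n = sumOfProducts N (λ i → M i n) k

-- Since exp ((1 + x/d) t d) - exp (t d) = exp (t d) (exp (x t) - 1), the d-th
-- summand of the series of Ψ is μ(d) (exp (x t) - 1) (1 + 1 / (exp (t d) - 1)).
-- For n ≥ 2 the sum of μ(d) over d ∣ n vanishes, so the series of Ψ is the
-- series of M times (exp (x t) - 1) / t.  Taking N-th powers, the theorem
-- becomes a comparison of coefficients with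
-- (exp (x t) - 1)^N = Σ_l N! S(l,N) x^l t^l / l!.
module Submission where

open import Defs
open import Algebra.Bundles using (CommutativeRing)
import Algebra.Construct.Pointwise as Pointwise
open import Algebra.Morphism.Structures using (module RingMorphisms)
import Algebra.Properties.CommutativeSemiring.Exp as Exp
import Algebra.Properties.Ring as RingProperties
import Algebra.Properties.Semiring.Sum as Sum
import Algebra.Solver.Ring.NaturalCoefficients.Default as Solver
open import Data.Bool.Base using (true; false; if_then_else_)
open import Data.Fin.Base using (Fin; toℕ)
import Data.Fin.Properties as Fin
open import Data.Integer.Base as ℤ using (+_; -1ℤ; 0ℤ)
import Data.Integer.Properties as ℤ
open import Data.List.Base as List using (List; []; _∷_; _++_; length; concatMap; applyUpTo; upTo)
open import Data.List.Membership.Propositional using (_∈_)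
open import Data.List.Properties using (map-∘)
open import Data.List.Relation.Binary.Permutation.Propositional using (_↭_; ↭-sym; ↭⇒↭ₛ)
open import Data.List.Relation.Binary.Permutation.Propositional.Properties using (↭-length)
import Data.List.Relation.Binary.Permutation.Setoid.Properties as ↭ₛ
open import Data.List.Relation.Unary.All using (_∷_)
open import Data.List.Relation.Unary.All.Properties using (¬Any⇒All¬; All¬⇒¬Any)
open import Data.List.Relation.Unary.AllPairs using (_∷_)
open import Data.List.Relation.Unary.Unique.DecPropositional using (unique?)
open import Data.List.Relation.Unary.Unique.Propositional using (Unique)
open import Data.Nat.Base as ℕ using (ℕ; zero; suc; _∸_; _!; _≤_; s≤s; NonZero)
open import Data.Nat.Combinatorics using (_C_; nCk≡n!/k![n-k]!; k![n∸k]!∣n!)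
open import Data.Nat.Coprimality using (Coprime; coprime-divisor)
open import Data.Nat.Divisibility
  using (_∣_; divides; _∣?_; ∣⇒≤; >⇒∤; ∣-refl; ∣-trans; m∣m*n; n∣m*n; ∣m+n∣m⇒∣n; *-monoˡ-∣; *-cancelʳ-∣)
open import Data.Nat.DivMod using (m/n*n≡m)
open import Data.Nat.ListAction.Properties using (∈⇒∣product)
open import Data.Nat.Primality using (Prime; prime⇒nonZero; prime⇒irreducible)
open import Data.Nat.Primality.Factorisation
  using (module PrimeFactorisation; factors; factorise; factorisationUnique; factorisationHasAllPrimeFactors)
import Data.Nat.Properties as ℕ
open import Data.Nat.Properties using (_≟_; _!≢0; _!*_!≢0)
open import Data.Nat.Solver using (module +-*-Solver)
open import Data.Product.Base using (∃; _×_; _,_)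
open import Data.Rational.Base as ℚ using (ℚ)
import Data.Rational.Properties as ℚ
open import Data.Rational.Unnormalised.Base as ℚᵘ using (mkℚᵘ; *≡*)
import Data.Rational.Unnormalised.Properties as ℚᵘ
open import Data.Sum.Base using (inj₁; inj₂)
open import Data.Vec.Base as Vec using (Vec; []; _∷_)
open import Function.Base using (_∘_)
open import Level using (Level)
open import Relation.Binary.PropositionalEquality as ≡ using (_≡_)
import Relation.Binary.Reasoning.Setoid as ≈-Reasoning
open import Relation.Nullary.Decidable using (Dec; yes; no; ⌊_⌋)
open import Relation.Nullary.Negation using (¬_; contradiction)

-- The series exp (t d) - 1 has no constant term, so it cannot be inverted. Division goes through D
-- = (exp (t d) - 1) / t instead, whose constant coefficient d is a unit because the scalars are
-- rational, and the identity for the d-th summand is verified after multiplication by D. The sum of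
-- μ vanishes because of a prime p dividing n: with n = m p, a divisor d prime to p is paired with p
-- d, where μ changes sign, while a divisor p d with p ∣ d contributes 0. Neither the addition law
-- of exp nor the powers of exp (x t) - 1 are expanded binomially. Both follow from a first-order
-- differential equation, read as a recursion on coefficients in which the degree, a positive
-- integer, can be cancelled. The index k + N - j arises from the factor 1 / t: coefficient k - j of
-- ((exp (x t) - 1) / t)^N is coefficient N + (k - j) of (exp (x t) - 1)^N.

if-true : ∀ {a p} {X : Set a} {P : Set p} {x y : X} (P? : Dec P) → P →
          (if ⌊ P? ⌋ then x else y) ≡ x
if-true (yes _) _ = ≡.refl
if-true (no ¬p) p = contradiction p ¬p

if-false : ∀ {a p} {X : Set a} {P : Set p} {x y : X} (P? : Dec P) → ¬ P →
           (if ⌊ P? ⌋ then x else y) ≡ y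
if-false (yes p) ¬p = contradiction p ¬p
if-false (no _)  _  = ≡.refl

-- The Möbius function at a prime multiple

Unique-resp-↭ : {xs ys : List ℕ} → xs ↭ ys → Unique xs → Unique ys
Unique-resp-↭ p = ↭ₛ.Unique-resp-↭ (≡.setoid ℕ) (↭⇒↭ₛ p)

module _ {p d : ℕ} (pPrime : Prime p) .{{_ : NonZero d}} where

  private
    instance
      p≢0  = prime⇒nonZero pPrime
      pd≢0 = ℕ.m*n≢0 p d

    fd = factorise d

    ps  = factors fd
    ps′ = factors (factorise (p ℕ.* d))

    -- Unique factorisation: `p ∷ ps` is itself a prime factorisation of `p * d`. Hence `μ (p * d)`
    -- depends only on whether `ps` has repetitions and whether `p` occurs in it.
    ps′↭p∷ps : ps′ ↭ p ∷ ps
    ps′↭p∷ps = factorisationUnique (factorise (p ℕ.* d)) (record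
      { factors         = p ∷ ps
      ; isFactorisation = ≡.cong (p ℕ.*_) (PrimeFactorisation.isFactorisation fd)
      ; factorsPrime    = pPrime ∷ PrimeFactorisation.factorsPrime fd
      })

    p∈ps⇒p∣d : p ∈ ps → p ∣ d
    p∈ps⇒p∣d p∈ps = ≡.subst (p ∣_) (≡.sym (PrimeFactorisation.isFactorisation fd)) (∈⇒∣product p∈ps)

    p∣d⇒p∈ps : p ∣ d → p ∈ ps
    p∣d⇒p∈ps p∣d = factorisationHasAllPrimeFactors pPrime
      (≡.subst (p ∣_) (PrimeFactorisation.isFactorisation fd) p∣d)
      (PrimeFactorisation.factorsPrime fd)

  μ[p*d]≡0 : p ∣ d → μ (p ℕ.* d) ≡ 0ℤ
  μ[p*d]≡0 p∣d = if-false (unique? _≟_ ps′) λ ps′! → case (Unique-resp-↭ ps′↭p∷ps ps′!)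
    where
    case : ¬ Unique (p ∷ ps)
    case (p∉ps ∷ _) = All¬⇒¬Any p∉ps (p∣d⇒p∈ps p∣d)

  μ[p*d]≡-μ[d] : ¬ p ∣ d → μ (p ℕ.* d) ≡ ℤ.- μ d
  μ[p*d]≡-μ[d] p∤d with unique? _≟_ ps
  ... | yes ps! = begin
    μ (p ℕ.* d)                ≡⟨ if-true (unique? _≟_ ps′) ps′! ⟩
    -1ℤ ℤ.^ length ps′         ≡⟨ ≡.cong (-1ℤ ℤ.^_) (↭-length ps′↭p∷ps) ⟩
    -1ℤ ℤ.* -1ℤ ℤ.^ length ps  ≡⟨ ℤ.-1*i≡-i _ ⟩
    ℤ.- -1ℤ ℤ.^ length ps      ∎
    where
    open ≡.≡-Reasoning
    ps′! : Unique ps′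
    ps′! = Unique-resp-↭ (↭-sym ps′↭p∷ps) (¬Any⇒All¬ ps (p∤d ∘ p∈ps⇒p∣d) ∷ ps!)
  -- In this branch `ℤ.- μ d` computes to `0ℤ`, and a repetition in `ps` persists in `p ∷ ps`.
  ... | no ¬ps! = if-false (unique? _≟_ ps′) λ ps′! → case (Unique-resp-↭ ps′↭p∷ps ps′!)
    where
    case : ¬ Unique (p ∷ ps)
    case (_ ∷ ps!) = ¬ps! ps!

-- Fractions of integers as rational numbers

-- A fraction `i ℚ./ d` is reduced by a gcd, which does not compute for variables. Identities
-- between fractions are therefore proved for unnormalised rationals, where they are identities of
-- integers, and transported along `ℚ.fromℚᵘ`.
fromℚᵘ-homo-+ : ∀ p q → ℚ.fromℚᵘ (p ℚᵘ.+ q) ≡ ℚ.fromℚᵘ p ℚ.+ ℚ.fromℚᵘ q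
fromℚᵘ-homo-+ p q = ℚ.toℚᵘ-injective (begin
  ℚ.toℚᵘ (ℚ.fromℚᵘ (p ℚᵘ.+ q))
    ≈⟨ ℚ.toℚᵘ-fromℚᵘ (p ℚᵘ.+ q) ⟩
  p ℚᵘ.+ q
    ≈⟨ ℚᵘ.+-cong {x = ℚ.toℚᵘ (ℚ.fromℚᵘ p)} {y = p} (ℚ.toℚᵘ-fromℚᵘ p) (ℚ.toℚᵘ-fromℚᵘ q) ⟨
  ℚ.toℚᵘ (ℚ.fromℚᵘ p) ℚᵘ.+ ℚ.toℚᵘ (ℚ.fromℚᵘ q)
    ≈⟨ ℚ.toℚᵘ-homo-+ (ℚ.fromℚᵘ p) (ℚ.fromℚᵘ q) ⟨
  ℚ.toℚᵘ (ℚ.fromℚᵘ p ℚ.+ ℚ.fromℚᵘ q) ∎)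
  where open ≈-Reasoning ℚᵘ.≃-setoid

fromℚᵘ-homo-* : ∀ p q → ℚ.fromℚᵘ (p ℚᵘ.* q) ≡ ℚ.fromℚᵘ p ℚ.* ℚ.fromℚᵘ q
fromℚᵘ-homo-* p q = ℚ.toℚᵘ-injective (begin
  ℚ.toℚᵘ (ℚ.fromℚᵘ (p ℚᵘ.* q))
    ≈⟨ ℚ.toℚᵘ-fromℚᵘ (p ℚᵘ.* q) ⟩
  p ℚᵘ.* q
    ≈⟨ ℚᵘ.*-cong {x = ℚ.toℚᵘ (ℚ.fromℚᵘ p)} {y = p} (ℚ.toℚᵘ-fromℚᵘ p) (ℚ.toℚᵘ-fromℚᵘ q) ⟨
  ℚ.toℚᵘ (ℚ.fromℚᵘ p) ℚᵘ.* ℚ.toℚᵘ (ℚ.fromℚᵘ q)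
    ≈⟨ ℚ.toℚᵘ-homo-* (ℚ.fromℚᵘ p) (ℚ.fromℚᵘ q) ⟨
  ℚ.toℚᵘ (ℚ.fromℚᵘ p ℚ.* ℚ.fromℚᵘ q) ∎)
  where open ≈-Reasoning ℚᵘ.≃-setoid

/1-homo-+ : ∀ i j → (i ℤ.+ j) ℚ./ 1 ≡ i ℚ./ 1 ℚ.+ j ℚ./ 1
/1-homo-+ i j = ≡.trans
  (ℚ.fromℚᵘ-cong {mkℚᵘ (i ℤ.+ j) 0} {mkℚᵘ i 0 ℚᵘ.+ mkℚᵘ j 0}
    (*≡* (≡.cong (ℤ._* + 1) (≡.sym (≡.cong₂ ℤ._+_ (ℤ.*-identityʳ i) (ℤ.*-identityʳ j))))))
  (fromℚᵘ-homo-+ (mkℚᵘ i 0) (mkℚᵘ j 0))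

/1-homo-* : ∀ i j → (i ℤ.* j) ℚ./ 1 ≡ (i ℚ./ 1) ℚ.* (j ℚ./ 1)
/1-homo-* i j = fromℚᵘ-homo-* (mkℚᵘ i 0) (mkℚᵘ j 0)

/≡/1*1/ : ∀ i d .{{_ : NonZero d}} → i ℚ./ d ≡ (i ℚ./ 1) ℚ.* (+ 1 ℚ./ d)
/≡/1*1/ i zero {{()}}
/≡/1*1/ i (suc d) = ≡.trans
  (ℚ.fromℚᵘ-cong {mkℚᵘ i d} {mkℚᵘ i 0 ℚᵘ.* mkℚᵘ (+ 1) d} (*≡* (
    ≡.cong₂ ℤ._*_ (≡.sym (ℤ.*-identityʳ i)) (≡.cong (λ m → + suc m) (ℕ.+-identityʳ d)))))
  (fromℚᵘ-homo-* (mkℚᵘ i 0) (mkℚᵘ (+ 1) d))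

d/d≡1 : ∀ d .{{_ : NonZero d}} → + d ℚ./ d ≡ ℚ.1ℚ
d/d≡1 zero {{()}}
d/d≡1 (suc d) = ℚ.fromℚᵘ-cong {mkℚᵘ (+ suc d) d} {mkℚᵘ (+ 1) 0}
  (*≡* (ℤ.*-comm (+ suc d) (+ 1)))

-- The ring of formal power series, and the exponential

module PowerSeries {c ℓ} (A : ℚ-Algebra c ℓ) where

  open MöbiusBernoulli A
  open RingMorphisms ℚ.+-*-rawRing rawRing using (IsRingHomomorphism)
  open IsRingHomomorphism ι-isRingHomomorphism using (+-homo; *-homo; 0#-homo; 1#-homo)
  open Exp commutativeSemiring using (^-congˡ)
  open RingProperties ring using (+-inverseˡ-unique)
  module A-Reasoning = ≈-Reasoning setoid
  module A-Solver = Solver commutativeSemiring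
  open A-Solver using (solve; con; _:+_; _:*_; _:=_)

  fromℤ-+ : ∀ i j → fromℤ (i ℤ.+ j) ≈ fromℤ i + fromℤ j
  fromℤ-+ i j = trans (reflexive (≡.cong ι (/1-homo-+ i j))) (+-homo _ _)

  fromℕ-+ : ∀ m n → fromℕ (m ℕ.+ n) ≈ fromℕ m + fromℕ n
  fromℕ-+ m n = fromℤ-+ (+ m) (+ n)

  fromℕ-* : ∀ m n → fromℕ (m ℕ.* n) ≈ fromℕ m * fromℕ n
  fromℕ-* m n = trans
    (reflexive (≡.cong ι (≡.trans (≡.cong (ℚ._/ 1) (ℤ.pos-* m n)) (/1-homo-* (+ m) (+ n)))))
    (*-homo _ _)

  fromℕ-0 : fromℕ 0 ≈ 0#
  fromℕ-0 = 0#-homo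

  fromℕ-1 : fromℕ 1 ≈ 1#
  fromℕ-1 = 1#-homo

  fromℤ-neg : ∀ z → fromℤ (ℤ.- z) ≈ - fromℤ z
  fromℤ-neg z = +-inverseˡ-unique _ _ (begin
    fromℤ (ℤ.- z) + fromℤ z  ≈⟨ fromℤ-+ (ℤ.- z) z ⟨
    fromℤ (ℤ.- z ℤ.+ z)      ≡⟨ ≡.cong fromℤ (ℤ.+-inverseˡ z) ⟩
    fromℤ ℤ.0ℤ               ≈⟨ 0#-homo ⟩
    0#                       ∎)
    where open A-Reasoning

  ι-/ : ∀ m d .{{_ : NonZero d}} → ι (+ m ℚ./ d) ≈ fromℕ m * 1/ d
  ι-/ m d = trans (reflexive (≡.cong ι (/≡/1*1/ (+ m) d))) (*-homo _ _)

  *-1/ : ∀ d .{{_ : NonZero d}} → fromℕ d * 1/ d ≈ 1#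
  *-1/ d = trans (sym (ι-/ d d)) (trans (reflexive (≡.cong ι (d/d≡1 d))) 1#-homo)

  -- Positive integers are units of a ℚ-algebra. This is what allows a coefficient recursion to be
  -- divided by the degree.
  fromℕ-cancelˡ : ∀ d .{{_ : NonZero d}} {x y} → fromℕ d * x ≈ fromℕ d * y → x ≈ y
  fromℕ-cancelˡ d {x} {y} dx≈dy = begin
    x                     ≈⟨ lemma x ⟨
    1/ d * (fromℕ d * x)  ≈⟨ *-congˡ dx≈dy ⟩
    1/ d * (fromℕ d * y)  ≈⟨ lemma y ⟩
    y                     ∎
    where
    open A-Reasoning
    lemma : ∀ z → 1/ d * (fromℕ d * z) ≈ z
    lemma z = begin
      1/ d * (fromℕ d * z)  ≈⟨ *-assoc _ _ _ ⟨
      1/ d * fromℕ d * z    ≈⟨ *-congʳ (trans (*-comm _ _) (*-1/ d)) ⟩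
      1# * z                ≈⟨ *-identityˡ z ⟩
      z                     ∎

  1/[0!] : 1/[ 0 !] ≈ 1#
  1/[0!] = 1#-homo

  suc*1/[suc!] : ∀ k → fromℕ (suc k) * 1/[ suc k !] ≈ 1/[ k !]
  suc*1/[suc!] k = fromℕ-cancelˡ (k !) {{k !≢0}} (begin
    fromℕ (k !) * (fromℕ (suc k) * 1/[ suc k !])  ≈⟨ *-assoc _ _ _ ⟨
    fromℕ (k !) * fromℕ (suc k) * 1/[ suc k !]    ≈⟨ *-congʳ (trans (*-comm _ _) (sym (fromℕ-* (suc k) (k !)))) ⟩
    fromℕ (suc k !) * 1/[ suc k !]                ≈⟨ *-1/ (suc k !) {{suc k !≢0}} ⟩
    1#                                            ≈⟨ *-1/ (k !) {{k !≢0}} ⟨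
    fromℕ (k !) * 1/[ k !]                        ∎)
    where open A-Reasoning

  infix 4 _≈ₛ_

  _≈ₛ_ : Series → Series → Set ℓ
  F ≈ₛ G = ∀ k → F k ≈ G k

  -- By definition `(F *ₛ G) (suc k)` unfolds to `F 0 * G (suc k) + (shift F *ₛ G) k`. The ring laws
  -- are inductions on `k` along this equation, with the left factor varying.
  *ₛ-cong : ∀ {F F′ G G′} → F ≈ₛ F′ → G ≈ₛ G′ → F *ₛ G ≈ₛ F′ *ₛ G′
  *ₛ-cong F≈F′ G≈G′ zero    = +-congʳ (*-cong (F≈F′ 0) (G≈G′ 0))
  *ₛ-cong F≈F′ G≈G′ (suc k) =
    +-cong (*-cong (F≈F′ 0) (G≈G′ (suc k))) (*ₛ-cong (λ i → F≈F′ (suc i)) G≈G′ k)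

  *ₛ-congˡ : ∀ F {G G′} → G ≈ₛ G′ → F *ₛ G ≈ₛ F *ₛ G′
  *ₛ-congˡ F {G} {G′} G≈G′ = *ₛ-cong {F} {F} {G} {G′} (λ _ → refl) G≈G′

  *ₛ-congʳ : ∀ H {F F′} → F ≈ₛ F′ → F *ₛ H ≈ₛ F′ *ₛ H
  *ₛ-congʳ H {F} {F′} F≈F′ = *ₛ-cong {F} {F′} {H} {H} F≈F′ (λ _ → refl)

  *ₛ-head : ∀ F G → (F *ₛ G) 0 ≈ F 0 * G 0
  *ₛ-head F G = +-identityʳ _

  *ₛ-zeroˡ : ∀ G → (λ _ → 0#) *ₛ G ≈ₛ (λ _ → 0#)
  *ₛ-zeroˡ G zero    = trans (+-identityʳ _) (zeroˡ _)
  *ₛ-zeroˡ G (suc k) = trans (+-cong (zeroˡ _) (*ₛ-zeroˡ G k)) (+-identityʳ _)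

  *ₛ-identityˡ : ∀ G → 1ₛ *ₛ G ≈ₛ G
  *ₛ-identityˡ G zero    = trans (+-identityʳ _) (*-identityˡ _)
  *ₛ-identityˡ G (suc k) = trans (+-cong (*-identityˡ _) (*ₛ-zeroˡ G k)) (+-identityʳ _)

  *ₛ-distribʳ-+ : ∀ H F G → (λ k → F k + G k) *ₛ H ≈ₛ (λ k → (F *ₛ H) k + (G *ₛ H) k)
  *ₛ-distribʳ-+ H F G zero    =
    solve 3 (λ f g h → (f :+ g) :* h :+ con 0 := f :* h :+ con 0 :+ (g :* h :+ con 0)) refl (F 0) (G 0) (H 0)
  *ₛ-distribʳ-+ H F G (suc k) = trans (+-congˡ (*ₛ-distribʳ-+ H (shift F) (shift G) k))
    (solve 5 (λ f g h u v → (f :+ g) :* h :+ (u :+ v) := (f :* h :+ u) :+ (g :* h :+ v))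
      refl (F 0) (G 0) (H (suc k)) _ _)

  -- Peels off the last term of the convolution, whereas unfolding peels off the first; exchanging
  -- the factors exchanges the two ends.
  *ₛ-suc : ∀ F G k → (F *ₛ G) (suc k) ≈ (F *ₛ shift G) k + F (suc k) * G 0
  *ₛ-suc F G zero    =
    solve 4 (λ a b c d → a :* b :+ (c :* d :+ con 0) := a :* b :+ con 0 :+ c :* d) refl (F 0) (G 1) (F 1) (G 0)
  *ₛ-suc F G (suc k) = trans (+-congˡ (*ₛ-suc (shift F) G k)) (sym (+-assoc _ _ _))

  *ₛ-comm : ∀ F G → F *ₛ G ≈ₛ G *ₛ F
  *ₛ-comm F G zero    = +-congʳ (*-comm _ _)
  *ₛ-comm F G (suc k) = begin
    F 0 * G (suc k) + (shift F *ₛ G) k  ≈⟨ +-comm _ _ ⟩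
    (shift F *ₛ G) k + F 0 * G (suc k)  ≈⟨ +-cong (*ₛ-comm (shift F) G k) (*-comm _ _) ⟩
    (G *ₛ shift F) k + G (suc k) * F 0  ≈⟨ *ₛ-suc G F k ⟨
    (G *ₛ F) (suc k)                    ∎
    where open A-Reasoning

  ·ₛ-*ₛ : ∀ a F G → (a ·ₛ F) *ₛ G ≈ₛ a ·ₛ (F *ₛ G)
  ·ₛ-*ₛ a F G zero    = solve 3 (λ a f g → a :* f :* g :+ con 0 := a :* (f :* g :+ con 0)) refl a (F 0) (G 0)
  ·ₛ-*ₛ a F G (suc k) = trans (+-congˡ (·ₛ-*ₛ a (shift F) G k))
    (solve 4 (λ a f g u → a :* f :* g :+ a :* u := a :* (f :* g :+ u)) refl a (F 0) (G (suc k)) _)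

  *ₛ-assoc : ∀ F G H → (F *ₛ G) *ₛ H ≈ₛ F *ₛ (G *ₛ H)
  *ₛ-assoc F G H zero    =
    solve 3 (λ f g h → (f :* g :+ con 0) :* h :+ con 0 := f :* (g :* h :+ con 0) :+ con 0) refl (F 0) (G 0) (H 0)
  *ₛ-assoc F G H (suc k) = begin
    (F *ₛ G) 0 * H (suc k) + (shift (F *ₛ G) *ₛ H) k
      -- The tail `shift (F *ₛ G)` is by unfolding the sum of `F 0 ·ₛ shift G` and `shift F *ₛ G`.
      ≈⟨ +-cong (*-congʳ (*ₛ-head F G)) (*ₛ-distribʳ-+ H (F 0 ·ₛ shift G) (shift F *ₛ G) k) ⟩
    F 0 * G 0 * H (suc k) + (((F 0 ·ₛ shift G) *ₛ H) k + ((shift F *ₛ G) *ₛ H) k)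
      ≈⟨ +-congˡ (+-cong (·ₛ-*ₛ (F 0) (shift G) H k) (*ₛ-assoc (shift F) G H k)) ⟩
    F 0 * G 0 * H (suc k) + (F 0 * (shift G *ₛ H) k + (shift F *ₛ (G *ₛ H)) k)
      ≈⟨ solve 5 (λ a b c d e → a :* b :* c :+ (a :* d :+ e) := a :* (b :* c :+ d) :+ e)
           refl (F 0) (G 0) (H (suc k)) _ _ ⟩
    F 0 * (G *ₛ H) (suc k) + (shift F *ₛ (G *ₛ H)) k ∎
    where open A-Reasoning

  *ₛ-distribˡ-+ : ∀ H F G → H *ₛ (λ k → F k + G k) ≈ₛ (λ k → (H *ₛ F) k + (H *ₛ G) k)
  *ₛ-distribˡ-+ H F G k = begin
    (H *ₛ (λ k → F k + G k)) k   ≈⟨ *ₛ-comm H (λ k → F k + G k) k ⟩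
    ((λ k → F k + G k) *ₛ H) k   ≈⟨ *ₛ-distribʳ-+ H F G k ⟩
    (F *ₛ H) k + (G *ₛ H) k      ≈⟨ +-cong (*ₛ-comm F H k) (*ₛ-comm G H k) ⟩
    (H *ₛ F) k + (H *ₛ G) k      ∎
    where open A-Reasoning

  seriesRing : CommutativeRing c ℓ
  seriesRing = record
    { Carrier = Series
    ; _≈_     = _≈ₛ_
    ; _+_     = λ F G k → F k + G k
    ; _*_     = _*ₛ_
    ; -_      = λ F k → - F k
    ; 0#      = λ _ → 0#
    ; 1#      = 1ₛ
    ; isCommutativeRing = record
      { isRing = record
        { +-isAbelianGroup = Pointwise.isAbelianGroup ℕ +-isAbelianGroup
        ; *-cong     = *ₛ-cong
        ; *-assoc    = *ₛ-assoc
        ; *-identity = *ₛ-identityˡ , λ F k → trans (*ₛ-comm F 1ₛ k) (*ₛ-identityˡ F k)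
        ; distrib    = *ₛ-distribˡ-+ , *ₛ-distribʳ-+
        }
      ; *-comm = *ₛ-comm
      }
    }

  module 𝕊 = CommutativeRing seriesRing
  module 𝕊-Solver = Solver 𝕊.commutativeSemiring
  open Exp 𝕊.commutativeSemiring public
    using () renaming (_^_ to _^ₛ_; ^-congˡ to ^ₛ-congˡ; ^-distrib-* to ^ₛ-distrib-*ₛ)

  module 𝕊-Reasoning = ≈-Reasoning 𝕊.setoid

  infixl 6 _+ₛ_

  _+ₛ_ : Series → Series → Series
  _+ₛ_ = 𝕊._+_

  -- Scalars embedded as series, so that the solver for the ring of series can treat a scalar
  -- multiple as a product.
  const : Carrier → Series
  const a = a ·ₛ 1ₛ

  const-*ₛ : ∀ a F → const a *ₛ F ≈ₛ a ·ₛ F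
  const-*ₛ a F k = trans (·ₛ-*ₛ a 1ₛ F k) (*-congˡ (*ₛ-identityˡ F k))

  const-+ : ∀ a b → const (a + b) ≈ₛ const a +ₛ const b
  const-+ a b k = distribʳ _ a b

  fromℕ-suc : ∀ k → fromℕ (suc k) ≈ 1# + fromℕ k
  fromℕ-suc k = trans (fromℕ-+ 1 k) (+-congʳ fromℕ-1)

  const-suc : ∀ k → const (fromℕ (suc k)) ≈ₛ 1ₛ +ₛ const (fromℕ k)
  const-suc k j =
    trans (*-congʳ (fromℕ-suc k)) (trans (distribʳ (1ₛ j) 1# (fromℕ k)) (+-congʳ (*-identityˡ (1ₛ j))))

  t*ₛ-zero : ∀ F → (t *ₛ F) 0 ≈ 0#
  t*ₛ-zero F = trans (*ₛ-head t F) (zeroˡ _)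

  shift-t : shift t ≈ₛ 1ₛ
  shift-t zero    = refl
  shift-t (suc _) = refl

  t*ₛ-suc : ∀ F k → (t *ₛ F) (suc k) ≈ F k
  t*ₛ-suc F k = begin
    0# * F (suc k) + (shift t *ₛ F) k  ≈⟨ +-cong (zeroˡ _) (*ₛ-congʳ F shift-t k) ⟩
    0# + (1ₛ *ₛ F) k                   ≈⟨ +-identityˡ _ ⟩
    (1ₛ *ₛ F) k                        ≈⟨ *ₛ-identityˡ F k ⟩
    F k                                ∎
    where open A-Reasoning

  t*ₛ-shift : ∀ F → F 0 ≈ 0# → t *ₛ shift F ≈ₛ F
  t*ₛ-shift F F₀≈0 zero    = trans (t*ₛ-zero (shift F)) (sym F₀≈0)
  t*ₛ-shift F F₀≈0 (suc k) = t*ₛ-suc (shift F) k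

  t^n*ₛ : ∀ n F k → (t ^ₛ n *ₛ F) (n ℕ.+ k) ≈ F k
  t^n*ₛ zero    F k = *ₛ-identityˡ F k
  t^n*ₛ (suc n) F k = begin
    (t *ₛ t ^ₛ n *ₛ F) (suc (n ℕ.+ k))    ≈⟨ *ₛ-assoc t (t ^ₛ n) F _ ⟩
    (t *ₛ (t ^ₛ n *ₛ F)) (suc (n ℕ.+ k))  ≈⟨ t*ₛ-suc (t ^ₛ n *ₛ F) (n ℕ.+ k) ⟩
    (t ^ₛ n *ₛ F) (n ℕ.+ k)               ≈⟨ t^n*ₛ n F k ⟩
    F k                                   ∎
    where open A-Reasoning

  -- A series whose constant coefficient is invertible is itself invertible: long division of `1ₛ`
  -- by `H` yields the inverse.
  *ₛ-cancelʳ : ∀ u {F G} H → u * H 0 ≈ 1# → F *ₛ H ≈ₛ G *ₛ H → F ≈ₛ G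
  *ₛ-cancelʳ u {F} {G} H uH₀≈1 FH≈GH k =
    trans (sym (lemma F k)) (trans (*ₛ-congʳ H⁻¹ FH≈GH k) (lemma G k))
    where
    H⁻¹ = divide u 1ₛ H

    lemma : ∀ F → F *ₛ H *ₛ H⁻¹ ≈ₛ F
    lemma F = begin
      F *ₛ H *ₛ H⁻¹    ≈⟨ *ₛ-assoc F H H⁻¹ ⟩
      F *ₛ (H *ₛ H⁻¹)  ≈⟨ *ₛ-congˡ F (*ₛ-comm H H⁻¹) ⟩
      F *ₛ (H⁻¹ *ₛ H)  ≈⟨ *ₛ-congˡ F (divide-correct u 1ₛ H uH₀≈1) ⟩
      F *ₛ 1ₛ          ≈⟨ 𝕊.*-identityʳ F ⟩
      F                ∎
      where open 𝕊-Reasoning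

  -- The Euler operator t · d/dt.
  θ : Series → Series
  θ F k = fromℕ k * F k

  θ-cong : ∀ {F G} → F ≈ₛ G → θ F ≈ₛ θ G
  θ-cong F≈G k = *-congˡ (F≈G k)

  θ-zero : ∀ F → θ F 0 ≈ 0#
  θ-zero F = trans (*-congʳ fromℕ-0) (zeroˡ _)

  θ-shift : ∀ F → shift (θ F) ≈ₛ shift F +ₛ θ (shift F)
  θ-shift F k = trans (*-congʳ (fromℕ-suc k)) (trans (distribʳ _ _ _) (+-congʳ (*-identityˡ _)))

  -- In degree `suc k` the first term of the convolution carries its whole weight on `G`, since
  -- `θ F 0` vanishes. In the remaining terms the weight `suc k` is `1 + k`; the extra copy of
  -- `shift F *ₛ G` is the one produced by `θ-shift`.
  θ-*ₛ : ∀ F G → θ (F *ₛ G) ≈ₛ θ F *ₛ G +ₛ F *ₛ θ G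
  θ-*ₛ F G zero = begin
    θ (F *ₛ G) 0                       ≈⟨ θ-zero (F *ₛ G) ⟩
    0#                                 ≈⟨ solve 2 (λ f g → con 0 := con 0 :* g :+ f :* con 0) refl (F 0) (G 0) ⟩
    0# * G 0 + F 0 * 0#                ≈⟨ +-cong (*-congʳ (θ-zero F)) (*-congˡ (θ-zero G)) ⟨
    θ F 0 * G 0 + F 0 * θ G 0          ≈⟨ +-cong (*ₛ-head (θ F) G) (*ₛ-head F (θ G)) ⟨
    (θ F *ₛ G +ₛ F *ₛ θ G) 0           ∎
    where open A-Reasoning
  θ-*ₛ F G (suc k) = begin
    fromℕ (suc k) * (f * g + FG)
      ≈⟨ distribˡ _ _ _ ⟩
    fromℕ (suc k) * (f * g) + fromℕ (suc k) * FG
      ≈⟨ +-congˡ (trans (*-congʳ (fromℕ-suc k)) (trans (distribʳ _ _ _)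
           (+-cong (*-identityˡ _) (θ-*ₛ (shift F) G k)))) ⟩
    fromℕ (suc k) * (f * g) + (FG + ((θ (shift F) *ₛ G) k + (shift F *ₛ θ G) k))
      ≈⟨ solve 6 (λ n f g u v w → n :* (f :* g) :+ (u :+ (v :+ w)) := con 0 :* g :+ (u :+ v) :+ (f :* (n :* g) :+ w))
           refl (fromℕ (suc k)) f g FG _ _ ⟩
    0# * g + (FG + (θ (shift F) *ₛ G) k) + (f * θ G (suc k) + (shift F *ₛ θ G) k)
      ≈⟨ +-congʳ (+-cong (*-congʳ (θ-zero F))
           (trans (*ₛ-congʳ G (θ-shift F) k) (*ₛ-distribʳ-+ G (shift F) (θ (shift F)) k))) ⟨
    (θ F *ₛ G) (suc k) + (F *ₛ θ G) (suc k) ∎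
    where
    open A-Reasoning
    f  = F 0
    g  = G (suc k)
    FG = (shift F *ₛ G) k

  θ-^ₛ : ∀ n F → θ (F ^ₛ suc n) ≈ₛ const (fromℕ (suc n)) *ₛ F ^ₛ n *ₛ θ F
  θ-^ₛ zero F = begin
    θ (F *ₛ 1ₛ)                      ≈⟨ θ-cong (𝕊.*-identityʳ F) ⟩
    θ F                              ≈⟨ *ₛ-identityˡ (θ F) ⟨
    1ₛ *ₛ θ F                        ≈⟨ *ₛ-congʳ (θ F) (λ k → trans (*-congʳ fromℕ-1) (*-identityˡ (1ₛ k))) ⟨
    const (fromℕ 1) *ₛ θ F           ≈⟨ *ₛ-congʳ (θ F) (𝕊.*-identityʳ (const (fromℕ 1))) ⟨
    const (fromℕ 1) *ₛ 1ₛ *ₛ θ F     ∎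
    where open 𝕊-Reasoning
  θ-^ₛ (suc n) F = begin
    θ (F *ₛ F ^ₛ suc n)
      ≈⟨ θ-*ₛ F (F ^ₛ suc n) ⟩
    θ F *ₛ F ^ₛ suc n +ₛ F *ₛ θ (F ^ₛ suc n)
      ≈⟨ 𝕊.+-congˡ {x = θ F *ₛ F ^ₛ suc n} (*ₛ-congˡ F (θ-^ₛ n F)) ⟩
    θ F *ₛ F ^ₛ suc n +ₛ F *ₛ (const (fromℕ (suc n)) *ₛ F ^ₛ n *ₛ θ F)
      ≈⟨ T.solve 4 (λ d f fn c →
             d T.:* (f T.:* fn) T.:+ f T.:* (c T.:* fn T.:* d) T.:= (T.con 1 T.:+ c) T.:* (f T.:* fn) T.:* d)
           𝕊.refl (θ F) F (F ^ₛ n) (const (fromℕ (suc n))) ⟩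
    (1ₛ +ₛ const (fromℕ (suc n))) *ₛ F ^ₛ suc n *ₛ θ F
      ≈⟨ *ₛ-congʳ (θ F) (*ₛ-congʳ (F ^ₛ suc n) (const-suc (suc n))) ⟨
    const (fromℕ (suc (suc n))) *ₛ F ^ₛ suc n *ₛ θ F ∎
    where
    open 𝕊-Reasoning
    module T = 𝕊-Solver

  -- The factor `t` makes this a recursion: the right side in degree `suc k` involves only
  -- coefficient `k` of the exponential.
  θ-exp : ∀ a → θ exp[ a t] ≈ₛ t *ₛ (const a *ₛ exp[ a t])
  θ-exp a zero    = trans (θ-zero exp[ a t]) (sym (t*ₛ-zero (const a *ₛ exp[ a t])))
  θ-exp a (suc k) = begin
    fromℕ (suc k) * (a * a ^ k * 1/[ suc k !])
      ≈⟨ solve 4 (λ n a b f → n :* (a :* b :* f) := a :* (b :* (n :* f))) refl _ a _ _ ⟩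
    a * (a ^ k * (fromℕ (suc k) * 1/[ suc k !]))
      ≈⟨ *-congˡ (*-congˡ (suc*1/[suc!] k)) ⟩
    a * exp[ a t] k
      ≈⟨ trans (t*ₛ-suc (const a *ₛ exp[ a t]) k) (const-*ₛ a exp[ a t] k) ⟨
    (t *ₛ (const a *ₛ exp[ a t])) (suc k) ∎
    where open A-Reasoning

  exp-zero : ∀ a → exp[ a t] 0 ≈ 1#
  exp-zero a = trans (*-identityˡ _) 1/[0!]

  exp-cong : ∀ {a b} → a ≈ b → exp[ a t] ≈ₛ exp[ b t]
  exp-cong a≈b k = *-congʳ (^-congˡ k a≈b)

  θ-exp*exp : ∀ a b → θ (exp[ a t] *ₛ exp[ b t]) ≈ₛ t *ₛ (const (a + b) *ₛ (exp[ a t] *ₛ exp[ b t]))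
  θ-exp*exp a b = begin
    θ (exp[ a t] *ₛ exp[ b t])
      ≈⟨ θ-*ₛ exp[ a t] exp[ b t] ⟩
    θ exp[ a t] *ₛ exp[ b t] +ₛ exp[ a t] *ₛ θ exp[ b t]
      ≈⟨ 𝕊.+-cong (*ₛ-congʳ exp[ b t] (θ-exp a)) (*ₛ-congˡ exp[ a t] (θ-exp b)) ⟩
    t *ₛ (const a *ₛ exp[ a t]) *ₛ exp[ b t] +ₛ exp[ a t] *ₛ (t *ₛ (const b *ₛ exp[ b t]))
      ≈⟨ T.solve 5 (λ t a b e f →
             t T.:* (a T.:* e) T.:* f T.:+ e T.:* (t T.:* (b T.:* f)) T.:= t T.:* ((a T.:+ b) T.:* (e T.:* f)))
           𝕊.refl t (const a) (const b) exp[ a t] exp[ b t] ⟩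
    t *ₛ ((const a +ₛ const b) *ₛ (exp[ a t] *ₛ exp[ b t]))
      ≈⟨ *ₛ-congˡ t (*ₛ-congʳ (exp[ a t] *ₛ exp[ b t]) (const-+ a b)) ⟨
    t *ₛ (const (a + b) *ₛ (exp[ a t] *ₛ exp[ b t])) ∎
    where
    open 𝕊-Reasoning
    module T = 𝕊-Solver

  -- Both sides solve θ F = t (a + b) F with F 0 = 1.
  exp-+ : ∀ a b → exp[ a t] *ₛ exp[ b t] ≈ₛ exp[ a + b t]
  exp-+ a b zero = begin
    (exp[ a t] *ₛ exp[ b t]) 0  ≈⟨ *ₛ-head exp[ a t] exp[ b t] ⟩
    exp[ a t] 0 * exp[ b t] 0   ≈⟨ *-cong (exp-zero a) (exp-zero b) ⟩
    1# * 1#                     ≈⟨ *-identityˡ 1# ⟩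
    1#                          ≈⟨ exp-zero (a + b) ⟨
    exp[ a + b t] 0             ∎
    where open A-Reasoning
  exp-+ a b (suc k) = fromℕ-cancelˡ (suc k) (begin
    θ (exp[ a t] *ₛ exp[ b t]) (suc k)
      ≈⟨ θ-exp*exp a b (suc k) ⟩
    (t *ₛ (const (a + b) *ₛ (exp[ a t] *ₛ exp[ b t]))) (suc k)
      ≈⟨ trans (t*ₛ-suc (const (a + b) *ₛ (exp[ a t] *ₛ exp[ b t])) k)
           (const-*ₛ (a + b) (exp[ a t] *ₛ exp[ b t]) k) ⟩
    (a + b) * (exp[ a t] *ₛ exp[ b t]) k
      ≈⟨ *-congˡ (exp-+ a b k) ⟩
    (a + b) * exp[ a + b t] k
      ≈⟨ trans (t*ₛ-suc (const (a + b) *ₛ exp[ a + b t]) k) (const-*ₛ (a + b) exp[ a + b t] k) ⟨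
    (t *ₛ (const (a + b) *ₛ exp[ a + b t])) (suc k)
      ≈⟨ θ-exp (a + b) (suc k) ⟨
    θ exp[ a + b t] (suc k) ∎)
    where open A-Reasoning

-- The sum of the Möbius function over the divisors

∃-prime-∣ : ∀ n → 2 ≤ n → ∃ λ p → Prime p × p ∣ n
∃-prime-∣ n@(suc _) 2≤n with factorise n
... | record { factors = [] ; isFactorisation = ≡.refl } = contradiction 2≤n λ { (s≤s ()) }
... | record { factors = p ∷ ps ; isFactorisation = n≡ ; factorsPrime = pPrime ∷ _ } =
  p , pPrime , ≡.subst (p ∣_) (≡.sym n≡) (m∣m*n _)

∤⇒coprime : ∀ {p d} → Prime p → ¬ p ∣ d → Coprime d p
∤⇒coprime pPrime p∤d (i∣d , i∣p) with prime⇒irreducible pPrime i∣p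
... | inj₁ i≡1    = i≡1
... | inj₂ ≡.refl = contradiction i∣d p∤d

module DivisorSums {c ℓ} (A : ℚ-Algebra c ℓ) where

  open MöbiusBernoulli A
  open PowerSeries A using (fromℤ-neg; fromℕ-0; module A-Reasoning)
  open Sum semiring
    using (sum-cong-≋; sum-replicate-zero; ∑-distrib-+)
  open A-Reasoning

  ∑-cong : ∀ n {f g : ℕ → Carrier} → (∀ i → f i ≈ g i) → ∑[ i < n ] f (toℕ i) ≈ ∑[ i < n ] g (toℕ i)
  ∑-cong n f≈g = sum-cong-≋ {n} (λ i → f≈g (toℕ i))

  ∑-zero : ∀ n {f : Fin n → Carrier} → (∀ i → f i ≈ 0#) → ∑[ i < n ] f i ≈ 0#
  ∑-zero n f≈0 = trans (sum-cong-≋ f≈0) (sum-replicate-zero n)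

  ∑-+ : ∀ m n (f : ℕ → Carrier) →
        ∑[ i < m ℕ.+ n ] f (toℕ i) ≈ ∑[ i < m ] f (toℕ i) + ∑[ i < n ] f (m ℕ.+ toℕ i)
  ∑-+ zero    n f = sym (+-identityˡ _)
  ∑-+ (suc m) n f = trans (+-congˡ (∑-+ m n (λ i → f (suc i)))) (sym (+-assoc _ _ _))

  -- The range from 1 to `m * p` falls into `m` blocks of length `p`, and only the last element of
  -- each block is a multiple of `p`. Removing a block replaces `f` by its translate by `p`, which
  -- still vanishes off the multiples of `p`.
  ∑-multiples : ∀ p .{{_ : NonZero p}} m (f : ℕ → Carrier) → (∀ d → ¬ p ∣ d → f d ≈ 0#) →
                ∑[ i < m ℕ.* p ] f (suc (toℕ i)) ≈ ∑[ i < m ] f (suc (toℕ i) ℕ.* p)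
  ∑-multiples p@(suc q) zero    f _   = refl
  ∑-multiples p@(suc q) (suc m) f f≈0 = begin
    ∑[ i < p ℕ.+ m ℕ.* p ] f (suc (toℕ i))
      ≈⟨ ∑-+ p (m ℕ.* p) (λ i → f (suc i)) ⟩
    ∑[ i < p ] f (suc (toℕ i)) + ∑[ i < m ℕ.* p ] f (suc (p ℕ.+ toℕ i))
      ≈⟨ +-cong first rest ⟩
    f (p ℕ.+ 0) + ∑[ i < m ] f (p ℕ.+ suc (toℕ i) ℕ.* p) ∎
    where
    last-term : ∀ n (g : ℕ → Carrier) → (∀ i → i ℕ.< n → g i ≈ 0#) → ∑[ i < suc n ] g (toℕ i) ≈ g n
    last-term zero    g _   = +-identityʳ _
    last-term (suc n) g g≈0 = trans
      (+-cong (g≈0 0 ℕ.z<s) (last-term n (λ i → g (suc i)) λ i i<n → g≈0 (suc i) (s≤s i<n)))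
      (+-identityˡ _)

    first : ∑[ i < p ] f (suc (toℕ i)) ≈ f (p ℕ.+ 0)
    first = trans
      (last-term q (λ i → f (suc i)) (λ i i<q → f≈0 (suc i) (>⇒∤ (s≤s i<q))))
      (reflexive (≡.cong f (≡.sym (ℕ.+-identityʳ p))))

    rest : ∑[ i < m ℕ.* p ] f (suc (p ℕ.+ toℕ i)) ≈ ∑[ i < m ] f (p ℕ.+ suc (toℕ i) ℕ.* p)
    rest = trans
      (∑-cong (m ℕ.* p) (λ i → reflexive (≡.cong f (≡.sym (ℕ.+-suc p i)))))
      (∑-multiples p m (λ d → f (p ℕ.+ d)) λ d p∤d →
        f≈0 (p ℕ.+ d) (λ p∣p+d → p∤d (∣m+n∣m⇒∣n p∣p+d ∣-refl)))

  module _ {p m : ℕ} (pPrime : Prime p) where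

    private
      instance
        p≢0 = prime⇒nonZero pPrime

      n = m ℕ.* p

      -- The summand as a function on all naturals, so that it can be evaluated at `p * d` without a
      -- proof of nonzeroness; the value at 0 is a mere default.
      term : ℕ → Carrier
      term zero      = 0#
      term d@(suc _) = if ⌊ d ∣? n ⌋ then fromℤ (μ d) else 0#

      term-∣ : ∀ d .{{_ : NonZero d}} → d ∣ n → term d ≡ fromℤ (μ d)
      term-∣ d@(suc _) d∣n = if-true (d ∣? n) d∣n

      term-∤ : ∀ d → ¬ d ∣ n → term d ≡ 0#
      term-∤ zero      _   = ≡.refl
      term-∤ d@(suc _) d∤n = if-false (d ∣? n) d∤n

      coprimePart multiplePart : ℕ → Carrier
      coprimePart  d = if ⌊ p ∣? d ⌋ then 0# else term d
      multiplePart d = if ⌊ p ∣? d ⌋ then term d else 0#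

      term-split : ∀ d → term d ≈ coprimePart d + multiplePart d
      term-split d with p ∣? d
      ... | yes _ = sym (+-identityˡ _)
      ... | no _  = sym (+-identityʳ _)

      multiplePart-∤ : ∀ d → ¬ p ∣ d → multiplePart d ≈ 0#
      multiplePart-∤ d p∤d = reflexive (if-false (p ∣? d) p∤d)

      multiplePart-* : ∀ d .{{_ : NonZero d}} → multiplePart (d ℕ.* p) ≈ term (p ℕ.* d)
      multiplePart-* d = reflexive (≡.trans (if-true (p ∣? (d ℕ.* p)) (n∣m*n d)) (≡.cong term (ℕ.*-comm d p)))

      ∣m*p⇒∣m : ∀ {d} → ¬ p ∣ d → d ∣ n → d ∣ m
      ∣m*p⇒∣m {d} p∤d d∣n =
        coprime-divisor (∤⇒coprime pPrime p∤d) (≡.subst (d ∣_) (ℕ.*-comm m p) d∣n)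

      -- μ (p d) is 0 if p ∣ d; otherwise p d ∣ m p iff d ∣ m p, and μ (p d) = - μ d.
      cancel : ∀ d .{{_ : NonZero d}} → coprimePart d + multiplePart (d ℕ.* p) ≈ 0#
      cancel d with p ∣? d
      ... | yes p∣d = trans (+-identityˡ _) (trans (multiplePart-* d) lemma)
        where
        lemma : term (p ℕ.* d) ≈ 0#
        lemma with (p ℕ.* d) ∣? n
        ... | no  pd∤n = reflexive (term-∤ (p ℕ.* d) pd∤n)
        ... | yes pd∣n = begin
          term (p ℕ.* d)       ≡⟨ term-∣ (p ℕ.* d) {{ℕ.m*n≢0 p d}} pd∣n ⟩
          fromℤ (μ (p ℕ.* d) {{ℕ.m*n≢0 p d}})  ≡⟨ ≡.cong fromℤ (μ[p*d]≡0 pPrime p∣d) ⟩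
          fromℤ 0ℤ             ≈⟨ fromℕ-0 ⟩
          0#                   ∎
      ... | no p∤d = trans (+-congˡ (multiplePart-* d)) lemma
        where
        lemma : term d + term (p ℕ.* d) ≈ 0#
        lemma with d ∣? m
        ... | no  d∤m = trans
          (+-cong
            (reflexive (term-∤ d λ d∣n → d∤m (∣m*p⇒∣m p∤d d∣n)))
            (reflexive (term-∤ (p ℕ.* d) λ pd∣n →
              d∤m (*-cancelʳ-∣ p (≡.subst (_∣ n) (ℕ.*-comm p d) pd∣n)))))
          (+-identityˡ _)
        ... | yes d∣m = begin
          term d + term (p ℕ.* d)
            ≡⟨ ≡.cong₂ _+_ (term-∣ d (∣-trans d∣m (m∣m*n p))) (term-∣ (p ℕ.* d) {{ℕ.m*n≢0 p d}} pd∣n) ⟩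
          fromℤ (μ d) + fromℤ (μ (p ℕ.* d) {{ℕ.m*n≢0 p d}})
            ≡⟨ ≡.cong (λ z → fromℤ (μ d) + fromℤ z) (μ[p*d]≡-μ[d] pPrime p∤d) ⟩
          fromℤ (μ d) + fromℤ (ℤ.- μ d)
            ≈⟨ +-congˡ (fromℤ-neg (μ d)) ⟩
          fromℤ (μ d) - fromℤ (μ d)
            ≈⟨ -‿inverseʳ _ ⟩
          0# ∎
          where
          pd∣n : p ℕ.* d ∣ n
          pd∣n = ≡.subst (_∣ n) (ℕ.*-comm d p) (*-monoˡ-∣ p d∣m)

      -- A divisor of `m * p` not divisible by `p` already divides `m`, hence is at most `m`.
      coprimePart-> : .{{_ : NonZero m}} → ∀ d → m ℕ.< d → coprimePart d ≈ 0#
      coprimePart-> d m<d with p ∣? d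
      ... | yes _  = refl
      ... | no p∤d = reflexive (term-∤ d λ d∣n → ℕ.<⇒≱ m<d (∣⇒≤ (∣m*p⇒∣m p∤d d∣n)))

      coprimePart-sum : .{{_ : NonZero m}} →
                        ∑[ i < n ] coprimePart (suc (toℕ i)) ≈ ∑[ i < m ] coprimePart (suc (toℕ i))
      coprimePart-sum = begin
        ∑[ i < m ℕ.* p ] f (toℕ i)
          ≡⟨ ≡.cong (λ k → ∑[ i < k ] f (toℕ i))
               (≡.trans (≡.cong (m ℕ.*_) (≡.sym (ℕ.suc-pred p))) (ℕ.*-suc m (ℕ.pred p))) ⟩
        ∑[ i < m ℕ.+ m ℕ.* ℕ.pred p ] f (toℕ i)
          ≈⟨ ∑-+ m (m ℕ.* ℕ.pred p) f ⟩
        ∑[ i < m ] f (toℕ i) + ∑[ i < m ℕ.* ℕ.pred p ] f (m ℕ.+ toℕ i)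
          ≈⟨ +-congˡ (∑-zero (m ℕ.* ℕ.pred p) (λ i → coprimePart-> _ (s≤s (ℕ.m≤m+n m (toℕ i))))) ⟩
        ∑[ i < m ] f (toℕ i) + 0#
          ≈⟨ +-identityʳ _ ⟩
        ∑[ i < m ] f (toℕ i) ∎
        where
        f = λ i → coprimePart (suc i)

    -- The coprime part stops at `m`, and the multiples of `p` up to `m * p` are reindexed by
    -- `d * p` with `d` up to `m`. Both parts then run over the same range and cancel term by term.
    ∑∣μ[m*p]≈0 : .{{_ : NonZero m}} → ∑∣ (m ℕ.* p) (λ d → fromℤ (μ d)) ≈ 0#
    ∑∣μ[m*p]≈0 = begin
      ∑[ i < n ] term (suc (toℕ i))
        ≈⟨ ∑-cong n (λ i → term-split (suc i)) ⟩
      ∑[ i < n ] (coprimePart (suc (toℕ i)) + multiplePart (suc (toℕ i)))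
        ≈⟨ ∑-distrib-+ {n} (λ i → coprimePart (suc (toℕ i))) (λ i → multiplePart (suc (toℕ i))) ⟩
      ∑[ i < n ] coprimePart (suc (toℕ i)) + ∑[ i < n ] multiplePart (suc (toℕ i))
        ≈⟨ +-cong coprimePart-sum (∑-multiples p m multiplePart multiplePart-∤) ⟩
      ∑[ i < m ] coprimePart (suc (toℕ i)) + ∑[ i < m ] multiplePart (suc (toℕ i) ℕ.* p)
        ≈⟨ ∑-distrib-+ {m} (λ i → coprimePart (suc (toℕ i))) (λ i → multiplePart (suc (toℕ i) ℕ.* p)) ⟨
      ∑[ i < m ] (coprimePart (suc (toℕ i)) + multiplePart (suc (toℕ i) ℕ.* p))
        ≈⟨ ∑-zero m (λ i → cancel (suc (toℕ i))) ⟩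
      0# ∎

  ∑∣μ≈0 : ∀ n → 2 ≤ n → ∑∣ n (λ d → fromℤ (μ d)) ≈ 0#
  ∑∣μ≈0 n 2≤n with ∃-prime-∣ n 2≤n
  ... | p , pPrime , divides m@(suc _) ≡.refl = ∑∣μ[m*p]≈0 {p} {m} pPrime
  ... | p , pPrime , divides zero ≡.refl      = contradiction 2≤n λ ()

nCk*k!*[n∸k]!≡n! : ∀ {n k} → k ≤ n → (n C k) ℕ.* (k ! ℕ.* (n ∸ k) !) ≡ n !
nCk*k!*[n∸k]!≡n! {n} {k} k≤n = ≡.trans
  (≡.cong (ℕ._* (k ! ℕ.* (n ∸ k) !)) (nCk≡n!/k![n-k]! k≤n))
  (m/n*n≡m {{k !* (n ∸ k) !≢0}} (k![n∸k]!∣n! k≤n))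

-- Sums of products as coefficients of powers

module Products {c ℓ} (A : ℚ-Algebra c ℓ) where

  open MöbiusBernoulli A
  open PowerSeries A
  open DivisorSums A
  open A-Solver using (solve; con; _:+_; _:*_; _:=_)
  open RingProperties ring using (+-cancelʳ)
  open Sum semiring
    using (sum-cong-≋; *-distribˡ-sum; ∑-distrib-+)

  listSum : {X : Set} → (X → Carrier) → List X → Carrier
  listSum f xs = List.foldr _+_ 0# (List.map f xs)

  listSum-cong : {X : Set} {f g : X → Carrier} → (∀ x → f x ≈ g x) → ∀ xs → listSum f xs ≈ listSum g xs
  listSum-cong f≈g []       = refl
  listSum-cong f≈g (x ∷ xs) = +-cong (f≈g x) (listSum-cong f≈g xs)

  listSum-*ˡ : {X : Set} (a : Carrier) (f : X → Carrier) → ∀ xs → listSum (λ x → a * f x) xs ≈ a * listSum f xs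
  listSum-*ˡ a f []       = sym (zeroʳ a)
  listSum-*ˡ a f (x ∷ xs) = trans (+-congˡ (listSum-*ˡ a f xs)) (sym (distribˡ a _ _))

  listSum-++ : {X : Set} (f : X → Carrier) → ∀ xs ys → listSum f (xs ++ ys) ≈ listSum f xs + listSum f ys
  listSum-++ f []       ys = sym (+-identityˡ _)
  listSum-++ f (x ∷ xs) ys = trans (+-congˡ (listSum-++ f xs ys)) (sym (+-assoc _ _ _))

  listSum-concatMap : {X Y : Set} (f : Y → Carrier) (h : X → List Y) → ∀ xs →
                      listSum f (concatMap h xs) ≈ listSum (λ x → listSum f (h x)) xs
  listSum-concatMap f h []       = refl
  listSum-concatMap f h (x ∷ xs) = trans (listSum-++ f (h x) (concatMap h xs)) (+-congˡ (listSum-concatMap f h xs))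

  listSum-applyUpTo : (f : ℕ → Carrier) (g : ℕ → ℕ) → ∀ n → listSum f (applyUpTo g n) ≈ ∑[ i < n ] f (g (toℕ i))
  listSum-applyUpTo f g zero    = refl
  listSum-applyUpTo f g (suc n) = +-congˡ (listSum-applyUpTo f (λ i → g (suc i)) n)

  ∏ : ∀ {N} → (ℕ → Carrier) → Vec ℕ N → Carrier
  ∏ s is = Vec.foldr′ _*_ 1# (Vec.map s is)

  -- Choosing the first entry `i` leaves a tuple of sum `k ∸ i`: the recursion of `tuples` is the
  -- convolution `s *ₛ s ^ₛ N`.
  listSum-tuples : ∀ N s k → listSum (∏ s) (tuples N k) ≈ (s ^ₛ N) k
  listSum-tuples zero    s zero    = +-identityʳ 1#
  listSum-tuples zero    s (suc k) = refl
  listSum-tuples (suc N) s k       = begin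
    listSum (∏ s) (tuples (suc N) k)
      ≈⟨ listSum-concatMap (∏ s) h (upTo (suc k)) ⟩
    listSum (λ i → listSum (∏ s) (h i)) (upTo (suc k))
      ≈⟨ listSum-applyUpTo (λ i → listSum (∏ s) (h i)) (λ i → i) (suc k) ⟩
    ∑[ i ≤ k ] listSum (∏ s) (h (toℕ i))
      ≈⟨ sum-cong-≋ {suc k} (λ i → step (toℕ i)) ⟩
    ∑[ i ≤ k ] (s (toℕ i) * (s ^ₛ N) (k ∸ toℕ i)) ∎
    where
    open A-Reasoning
    h = λ i → List.map (i ∷_) (tuples N (k ∸ i))

    step : ∀ i → listSum (∏ s) (h i) ≈ s i * (s ^ₛ N) (k ∸ i)
    step i = begin
      listSum (∏ s) (h i)                               ≡⟨ ≡.cong (List.foldr _+_ 0#) (map-∘ (tuples N (k ∸ i))) ⟨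
      listSum (λ is → s i * ∏ s is) (tuples N (k ∸ i))  ≈⟨ listSum-*ˡ (s i) (∏ s) (tuples N (k ∸ i)) ⟩
      s i * listSum (∏ s) (tuples N (k ∸ i))            ≈⟨ *-congˡ (listSum-tuples N s (k ∸ i)) ⟩
      s i * (s ^ₛ N) (k ∸ i)                            ∎

  ∏-! : ∀ {N} (s : ℕ → Carrier) (is : Vec ℕ N) → ∏ (λ i → fromℕ (i !) * s i) is ≈ fromℕ (∏! is) * ∏ s is
  ∏-! s []       = sym (trans (*-identityʳ _) fromℕ-1)
  ∏-! s (i ∷ is) = begin
    fromℕ (i !) * s i * ∏ (λ i → fromℕ (i !) * s i) is
      ≈⟨ *-congˡ (∏-! s is) ⟩
    fromℕ (i !) * s i * (fromℕ (∏! is) * ∏ s is)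
      ≈⟨ solve 4 (λ a b c d → a :* b :* (c :* d) := a :* c :* (b :* d)) refl _ _ _ _ ⟩
    fromℕ (i !) * fromℕ (∏! is) * (s i * ∏ s is)
      ≈⟨ *-congʳ (fromℕ-* (i !) (∏! is)) ⟨
    fromℕ (i ! ℕ.* ∏! is) * (s i * ∏ s is) ∎
    where open A-Reasoning

  -- The factorials attached to the entries cancel the denominator of the multinomial coefficient.
  -- This translates `Ψ^` and `M^` into ordinary coefficients of powers of the generating series.
  sumOfProducts-! : ∀ N s k → sumOfProducts N (λ i → fromℕ (i !) * s i) k ≈ fromℕ (k !) * (s ^ₛ N) k
  sumOfProducts-! N s k = begin
    sumOfProducts N (λ i → fromℕ (i !) * s i) k         ≈⟨ listSum-cong term≈ (tuples N k) ⟩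
    listSum (λ is → fromℕ (k !) * ∏ s is) (tuples N k)  ≈⟨ listSum-*ˡ (fromℕ (k !)) (∏ s) (tuples N k) ⟩
    fromℕ (k !) * listSum (∏ s) (tuples N k)            ≈⟨ *-congˡ (listSum-tuples N s k) ⟩
    fromℕ (k !) * (s ^ₛ N) k                            ∎
    where
    open A-Reasoning

    term≈ : ∀ is → ι (multinomial k is) * ∏ (λ i → fromℕ (i !) * s i) is ≈ fromℕ (k !) * ∏ s is
    term≈ is = begin
      ι (multinomial k is) * ∏ (λ i → fromℕ (i !) * s i) is
        ≈⟨ *-cong (ι-/ (k !) (∏! is) {{∏!≢0 is}}) (∏-! s is) ⟩
      fromℕ (k !) * (1/ ∏! is) {{∏!≢0 is}} * (fromℕ (∏! is) * ∏ s is)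
        ≈⟨ solve 4 (λ a b c d → a :* b :* (c :* d) := a :* (c :* b) :* d) refl _ _ _ _ ⟩
      fromℕ (k !) * (fromℕ (∏! is) * (1/ ∏! is) {{∏!≢0 is}}) * ∏ s is
        ≈⟨ *-congʳ (trans (*-congˡ (*-1/ (∏! is) {{∏!≢0 is}})) (*-identityʳ _)) ⟩
      fromℕ (k !) * ∏ s is ∎

  -- Powers of exp (a t) - 1 and Stirling numbers

  exp[_t]-1 : Carrier → Series
  exp[ a t]-1 = exp[ a t] -ₛ 1ₛ

  exp-1-zero : ∀ a → exp[ a t]-1 0 ≈ 0#
  exp-1-zero a = trans (+-congʳ (exp-zero a)) (-‿inverseʳ 1#)

  1+[exp-1]≈exp : ∀ a → 1ₛ +ₛ exp[ a t]-1 ≈ₛ exp[ a t]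
  1+[exp-1]≈exp a k = begin
    1ₛ k + (exp[ a t] k - 1ₛ k)    ≈⟨ +-comm _ _ ⟩
    exp[ a t] k - 1ₛ k + 1ₛ k      ≈⟨ +-assoc _ _ _ ⟩
    exp[ a t] k + (- 1ₛ k + 1ₛ k)  ≈⟨ +-congˡ (-‿inverseˡ (1ₛ k)) ⟩
    exp[ a t] k + 0#               ≈⟨ +-identityʳ _ ⟩
    exp[ a t] k                    ∎
    where open A-Reasoning

  θ-exp-1 : ∀ a → θ exp[ a t]-1 ≈ₛ t *ₛ (const a *ₛ exp[ a t])
  θ-exp-1 a zero    = trans (θ-zero exp[ a t]-1) (sym (t*ₛ-zero (const a *ₛ exp[ a t])))
  θ-exp-1 a (suc k) = trans (*-congˡ lemma) (θ-exp a (suc k))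
    where
    lemma : exp[ a t]-1 (suc k) ≈ exp[ a t] (suc k)
    lemma = trans (sym (+-identityˡ _)) (1+[exp-1]≈exp a (suc k))

  -- Comparing coefficients in θ (F^(N+1)) = (N + 1) a t (F^(N+1) + F^N), where
  -- F = exp (a t) - 1, gives the recurrence of S.
  [exp-1]^ : ∀ a N l → (exp[ a t]-1 ^ₛ N) l ≈ fromℕ (N ! ℕ.* S l N) * exp[ a t] l
  [exp-1]^ a zero    zero    = sym (trans (*-cong fromℕ-1 (exp-zero a)) (*-identityˡ 1#))
  [exp-1]^ a zero    (suc l) = sym (trans (*-congʳ fromℕ-0) (zeroˡ _))
  [exp-1]^ a (suc N) zero    = begin
    (exp[ a t]-1 ^ₛ suc N) 0                ≈⟨ *ₛ-head exp[ a t]-1 (exp[ a t]-1 ^ₛ N) ⟩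
    exp[ a t]-1 0 * (exp[ a t]-1 ^ₛ N) 0    ≈⟨ *-congʳ (exp-1-zero a) ⟩
    0# * (exp[ a t]-1 ^ₛ N) 0               ≈⟨ trans (zeroˡ _) (sym (zeroˡ _)) ⟩
    0# * exp[ a t] 0                        ≈⟨ *-congʳ fromℕ-0 ⟨
    fromℕ 0 * exp[ a t] 0                   ≡⟨ ≡.cong (λ m → fromℕ m * exp[ a t] 0) (ℕ.*-zeroʳ (suc N !)) ⟨
    fromℕ (suc N ! ℕ.* 0) * exp[ a t] 0     ∎
    where open A-Reasoning
  [exp-1]^ a (suc N) (suc l) = fromℕ-cancelˡ (suc l) (begin
    θ (F ^ₛ suc N) (suc l)
      ≈⟨ ode (suc l) ⟩
    (t *ₛ (const n *ₛ (const a *ₛ (F ^ₛ N +ₛ F ^ₛ suc N)))) (suc l)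
      ≈⟨ t*ₛ-suc (const n *ₛ (const a *ₛ (F ^ₛ N +ₛ F ^ₛ suc N))) l ⟩
    (const n *ₛ (const a *ₛ (F ^ₛ N +ₛ F ^ₛ suc N))) l
      ≈⟨ trans (const-*ₛ n (const a *ₛ (F ^ₛ N +ₛ F ^ₛ suc N)) l)
           (*-congˡ (const-*ₛ a (F ^ₛ N +ₛ F ^ₛ suc N) l)) ⟩
    n * (a * ((F ^ₛ N) l + (F ^ₛ suc N) l))
      -- The induction is on `l` for all exponents at once: degree `l` is needed for both `N` and
      -- `suc N`.
      ≈⟨ *-congˡ (*-congˡ (+-cong ([exp-1]^ a N l) ([exp-1]^ a (suc N) l))) ⟩
    n * (a * (fromℕ (N ! ℕ.* S l N) * e + fromℕ (suc N ! ℕ.* S l (suc N)) * e))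
      ≈⟨ solve 5 (λ n a u v e → n :* (a :* (u :* e :+ v :* e)) := (n :* (u :+ v)) :* (a :* e))
           refl n a _ _ e ⟩
    n * (fromℕ (N ! ℕ.* S l N) + fromℕ (suc N ! ℕ.* S l (suc N))) * (a * e)
      ≈⟨ *-cong coefficient exponential ⟩
    fromℕ (suc N ! ℕ.* S (suc l) (suc N)) * (fromℕ (suc l) * exp[ a t] (suc l))
      ≈⟨ solve 3 (λ u v w → u :* (v :* w) := v :* (u :* w)) refl _ _ _ ⟩
    fromℕ (suc l) * (fromℕ (suc N ! ℕ.* S (suc l) (suc N)) * exp[ a t] (suc l)) ∎)
    where
    open A-Reasoning
    F = exp[ a t]-1
    n = fromℕ (suc N)
    e = exp[ a t] l

    ode : θ (F ^ₛ suc N) ≈ₛ t *ₛ (const n *ₛ (const a *ₛ (F ^ₛ N +ₛ F ^ₛ suc N)))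
    ode k = begin
      θ (F ^ₛ suc N) k
        ≈⟨ θ-^ₛ N F k ⟩
      (const n *ₛ F ^ₛ N *ₛ θ F) k
        ≈⟨ *ₛ-congˡ (const n *ₛ F ^ₛ N) (θ-exp-1 a) k ⟩
      (const n *ₛ F ^ₛ N *ₛ (t *ₛ (const a *ₛ exp[ a t]))) k
        -- Rewriting the exponential as `1ₛ +ₛ F` closes the equation over powers of `F`.
        ≈⟨ *ₛ-congˡ (const n *ₛ F ^ₛ N) (*ₛ-congˡ t (*ₛ-congˡ (const a) (1+[exp-1]≈exp a))) k ⟨
      (const n *ₛ F ^ₛ N *ₛ (t *ₛ (const a *ₛ (1ₛ +ₛ F)))) k
        ≈⟨ T.solve 5 (λ c f g t a →
             c T.:* g T.:* (t T.:* (a T.:* (T.con 1 T.:+ f))) T.:= t T.:* (c T.:* (a T.:* (g T.:+ f T.:* g))))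
             𝕊.refl (const n) F (F ^ₛ N) t (const a) k ⟩
      (t *ₛ (const n *ₛ (const a *ₛ (F ^ₛ N +ₛ F ^ₛ suc N)))) k ∎
      where module T = 𝕊-Solver

    coefficient : n * (fromℕ (N ! ℕ.* S l N) + fromℕ (suc N ! ℕ.* S l (suc N))) ≈
                  fromℕ (suc N ! ℕ.* S (suc l) (suc N))
    coefficient = begin
      n * (fromℕ (N ! ℕ.* S l N) + fromℕ (suc N ! ℕ.* S l (suc N)))
        ≈⟨ *-congˡ (fromℕ-+ (N ! ℕ.* S l N) (suc N ! ℕ.* S l (suc N))) ⟨
      n * fromℕ (N ! ℕ.* S l N ℕ.+ suc N ! ℕ.* S l (suc N))
        ≈⟨ fromℕ-* (suc N) (N ! ℕ.* S l N ℕ.+ suc N ! ℕ.* S l (suc N)) ⟨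
      fromℕ (suc N ℕ.* (N ! ℕ.* S l N ℕ.+ suc N ! ℕ.* S l (suc N)))
        ≡⟨ ≡.cong fromℕ (ℕS.solve 4 (λ n f s s′ →
             n ℕS.:* (f ℕS.:* s ℕS.:+ n ℕS.:* f ℕS.:* s′) ℕS.:= n ℕS.:* f ℕS.:* (n ℕS.:* s′ ℕS.:+ s))
             ≡.refl (suc N) (N !) (S l N) (S l (suc N))) ⟩
      fromℕ (suc N ! ℕ.* S (suc l) (suc N)) ∎
      where
      module ℕS = +-*-Solver

    exponential : a * e ≈ fromℕ (suc l) * exp[ a t] (suc l)
    exponential = begin
      a * e                                ≈⟨ const-*ₛ a exp[ a t] l ⟨
      (const a *ₛ exp[ a t]) l             ≈⟨ t*ₛ-suc (const a *ₛ exp[ a t]) l ⟨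
      (t *ₛ (const a *ₛ exp[ a t])) (suc l)  ≈⟨ θ-exp a (suc l) ⟨
      fromℕ (suc l) * exp[ a t] (suc l)    ∎

  -- As exp (a t) - 1 has no constant term, it is `t` times its shift; its N-th power therefore
  -- carries a factor `t ^ₛ N`, which moves coefficient `k` to `N + k`.
  shift-[exp-1]^ : ∀ a N k → (shift exp[ a t]-1 ^ₛ N) k ≈ (exp[ a t]-1 ^ₛ N) (N ℕ.+ k)
  shift-[exp-1]^ a N k = begin
    (F′ ^ₛ N) k                       ≈⟨ t^n*ₛ N (F′ ^ₛ N) k ⟨
    (t ^ₛ N *ₛ F′ ^ₛ N) (N ℕ.+ k)     ≈⟨ ^ₛ-distrib-*ₛ t F′ N (N ℕ.+ k) ⟨
    ((t *ₛ F′) ^ₛ N) (N ℕ.+ k)        ≈⟨ ^ₛ-congˡ N {t *ₛ F′} {exp[ a t]-1} (t*ₛ-shift exp[ a t]-1 (exp-1-zero a)) (N ℕ.+ k) ⟩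
    (exp[ a t]-1 ^ₛ N) (N ℕ.+ k)      ∎
    where
    open A-Reasoning
    F′ = shift exp[ a t]-1

  -- Divisor sums of quotients by exp (d t) - 1

  ∑∣-cong : ∀ n {f g : (d : ℕ) → .{{NonZero d}} → Carrier} →
            (∀ d .{{_ : NonZero d}} → f d ≈ g d) → ∑∣ n f ≈ ∑∣ n g
  ∑∣-cong n f≈g = sum-cong-≋ {n} λ i → lemma ⌊ suc (toℕ i) ∣? n ⌋ (f≈g (suc (toℕ i)))
    where
    lemma : ∀ b {x y} → x ≈ y → (if b then x else 0#) ≈ (if b then y else 0#)
    lemma true  x≈y = x≈y
    lemma false _   = refl

  ∑∣-+ : ∀ n (f g : (d : ℕ) → .{{NonZero d}} → Carrier) → ∑∣ n (λ d → f d + g d) ≈ ∑∣ n f + ∑∣ n g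
  ∑∣-+ n f g = trans (sum-cong-≋ {n} λ i → lemma ⌊ suc (toℕ i) ∣? n ⌋)
    (∑-distrib-+ {n}
      (λ i → if ⌊ suc (toℕ i) ∣? n ⌋ then f (suc (toℕ i)) else 0#)
      (λ i → if ⌊ suc (toℕ i) ∣? n ⌋ then g (suc (toℕ i)) else 0#))
    where
    lemma : ∀ b {x y} → (if b then x + y else 0#) ≈ (if b then x else 0#) + (if b then y else 0#)
    lemma true  = refl
    lemma false = sym (+-identityˡ 0#)

  ∑∣-*ˡ : ∀ n a (f : (d : ℕ) → .{{NonZero d}} → Carrier) → ∑∣ n (λ d → a * f d) ≈ a * ∑∣ n f
  ∑∣-*ˡ n a f = trans (sum-cong-≋ {n} λ i → lemma ⌊ suc (toℕ i) ∣? n ⌋)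
    (sym (*-distribˡ-sum {n} a (λ i → if ⌊ suc (toℕ i) ∣? n ⌋ then f (suc (toℕ i)) else 0#)))
    where
    lemma : ∀ b {x} → (if b then a * x else 0#) ≈ a * (if b then x else 0#)
    lemma true  = refl
    lemma false = sym (zeroʳ a)

  -- Serves to pull the factor (exp (x t) - 1) / t, common to all divisors, out of the divisor sum.
  ∑∣-*ₛ : ∀ n F (G : (d : ℕ) → .{{NonZero d}} → Series) →
          F *ₛ (λ k → ∑∣ n (λ d → G d k)) ≈ₛ (λ k → ∑∣ n (λ d → (F *ₛ G d) k))
  ∑∣-*ₛ n F G zero    = trans (*ₛ-head F (λ k → ∑∣ n (λ d → G d k))) (trans
    (sym (∑∣-*ˡ n (F 0) (λ d → G d 0)))
    (∑∣-cong n (λ d → sym (*ₛ-head F (G d)))))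
  ∑∣-*ₛ n F G (suc k) = trans
    (+-cong (sym (∑∣-*ˡ n (F 0) (λ d → G d (suc k)))) (∑∣-*ₛ n (shift F) G k))
    (sym (∑∣-+ n (λ d → F 0 * G d (suc k)) (λ d → (shift F *ₛ G d) k)))

  module _ (x : Carrier) (d : ℕ) .{{_ : NonZero d}} where

    private
      E D num : Series
      E = exp[ x t]-1
      D = shift exp[ fromℕ d t]-1
      num = exp[ (1# + x * 1/ d) * fromℕ d t] -ₛ exp[ fromℕ d t]

    -- The coefficient of t in exp (d t) - 1 is `d`. This is the hypothesis under which division by
    -- `D` is correct and `D` can be cancelled.
    unit : 1/ d * D 0 ≈ 1#
    unit = begin
      1/ d * (fromℕ d * 1# * 1/[ 1 !] + - 0#)  ≈⟨ *-congˡ (trans (sym (+-identityˡ _)) (1+[exp-1]≈exp (fromℕ d) 1)) ⟩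
      1/ d * (fromℕ d * 1# * 1/[ 1 !])         ≈⟨ *-congˡ (trans (*-cong (*-identityʳ _) 1/[0!]) (*-identityʳ _)) ⟩
      1/ d * fromℕ d                           ≈⟨ trans (*-comm _ _) (*-1/ d) ⟩
      1#                                       ∎
      where open A-Reasoning

    exponent : (1# + x * 1/ d) * fromℕ d ≈ fromℕ d + x
    exponent = begin
      (1# + x * 1/ d) * fromℕ d
        ≈⟨ solve 3 (λ x u d → (con 1 :+ x :* u) :* d := d :+ x :* (d :* u)) refl x (1/ d) (fromℕ d) ⟩
      fromℕ d + x * (fromℕ d * 1/ d)
        ≈⟨ +-congˡ (trans (*-congˡ (*-1/ d)) (*-identityʳ x)) ⟩
      fromℕ d + x ∎
      where open A-Reasoning

    -- The numerator is exp (d t) times `E`; substituting exp (d t) = 1 + t D gives E + t D E, and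
    -- `E` is t times its shift. Adding exp (d t) to both sides removes the subtraction in `num`,
    -- which leaves identities of semirings.
    num≈ : num ≈ₛ t *ₛ (shift E +ₛ D *ₛ E)
    num≈ k = +-cancelʳ (exp[ fromℕ d t] k) _ _ (begin
      num k + exp[ fromℕ d t] k
        ≈⟨ trans (+-assoc _ _ _) (trans (+-congˡ (-‿inverseˡ _)) (+-identityʳ _)) ⟩
      exp[ (1# + x * 1/ d) * fromℕ d t] k
        ≈⟨ exp-cong exponent k ⟩
      exp[ fromℕ d + x t] k
        ≈⟨ exp-+ (fromℕ d) x k ⟨
      (exp[ fromℕ d t] *ₛ exp[ x t]) k
        ≈⟨ *ₛ-congˡ exp[ fromℕ d t] (1+[exp-1]≈exp x) k ⟨
      (exp[ fromℕ d t] *ₛ (1ₛ +ₛ E)) k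
        ≈⟨ T.solve 2 (λ e f → e T.:* (T.con 1 T.:+ f) T.:= e T.:* f T.:+ e) 𝕊.refl exp[ fromℕ d t] E k ⟩
      (exp[ fromℕ d t] *ₛ E) k + exp[ fromℕ d t] k
        ≈⟨ +-congʳ (*ₛ-congʳ E (λ k → trans
             (+-congˡ (t*ₛ-shift exp[ fromℕ d t]-1 (exp-1-zero (fromℕ d)) k))
             (1+[exp-1]≈exp (fromℕ d) k)) k) ⟨
      ((1ₛ +ₛ t *ₛ D) *ₛ E) k + exp[ fromℕ d t] k
        ≈⟨ +-congʳ (T.solve 3 (λ t d e → (T.con 1 T.:+ t T.:* d) T.:* e T.:= e T.:+ t T.:* (d T.:* e)) 𝕊.refl t D E k) ⟩
      E k + (t *ₛ (D *ₛ E)) k + exp[ fromℕ d t] k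
        ≈⟨ +-congʳ (+-congʳ (t*ₛ-shift E (exp-1-zero x) k)) ⟨
      (t *ₛ shift E) k + (t *ₛ (D *ₛ E)) k + exp[ fromℕ d t] k
        ≈⟨ +-congʳ (𝕊.distribˡ t (shift E) (D *ₛ E) k) ⟨
      (t *ₛ (shift E +ₛ D *ₛ E)) k + exp[ fromℕ d t] k ∎)
      where
      open A-Reasoning
      module T = 𝕊-Solver

    -- exp (t d) (exp (x t) - 1) / (exp (t d) - 1)
    --   = (exp (x t) - 1) / (exp (t d) - 1) + (exp (x t) - 1).
    quotient≈ : ∀ m → m ·ₛ (num /exp[ d t]-1) ≈ₛ shift E *ₛ ((m ·ₛ t) /exp[ d t]-1) +ₛ m ·ₛ E
    -- Multiplication by `D` clears both quotients: `Q*D` and `B*D` replace them by their numerators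
    -- divided by t.
    quotient≈ m = *ₛ-cancelʳ (1/ d) D unit (begin
      (m ·ₛ Q) *ₛ D
        ≈⟨ ·ₛ-*ₛ m Q D ⟩
      m ·ₛ (Q *ₛ D)
        ≈⟨ (λ k → *-congˡ (Q*D k)) ⟩
      m ·ₛ (shift E +ₛ D *ₛ E)
        ≈⟨ const-*ₛ m (shift E +ₛ D *ₛ E) ⟨
      const m *ₛ (shift E +ₛ D *ₛ E)
        ≈⟨ T.solve 4 (λ c e d f → c T.:* (e T.:+ d T.:* f) T.:= e T.:* c T.:+ c T.:* f T.:* d)
             𝕊.refl (const m) (shift E) D E ⟩
      shift E *ₛ const m +ₛ const m *ₛ E *ₛ D
        ≈⟨ 𝕊.+-cong (*ₛ-congˡ (shift E) B*D) (*ₛ-congʳ D (λ k → sym (const-*ₛ m E k))) ⟨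
      shift E *ₛ (B *ₛ D) +ₛ (m ·ₛ E) *ₛ D
        ≈⟨ 𝕊.+-congʳ {x = (m ·ₛ E) *ₛ D} (*ₛ-assoc (shift E) B D) ⟨
      shift E *ₛ B *ₛ D +ₛ (m ·ₛ E) *ₛ D
        ≈⟨ *ₛ-distribʳ-+ D (shift E *ₛ B) (m ·ₛ E) ⟨
      (shift E *ₛ B +ₛ m ·ₛ E) *ₛ D ∎)
      where
      open 𝕊-Reasoning
      module T = 𝕊-Solver
      Q = num /exp[ d t]-1
      B = (m ·ₛ t) /exp[ d t]-1

      Q*D : Q *ₛ D ≈ₛ shift E +ₛ D *ₛ E
      Q*D k = trans (divide-correct (1/ d) (shift num) D unit k)
        (trans (num≈ (suc k)) (t*ₛ-suc (shift E +ₛ D *ₛ E) k))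

      B*D : B *ₛ D ≈ₛ const m
      B*D k = trans (divide-correct (1/ d) (shift (m ·ₛ t)) D unit k) (*-congˡ (shift-t k))

  Ψ-series≈ : ∀ x n → 2 ≤ n → Ψ-series x n ≈ₛ M-series n *ₛ shift exp[ x t]-1
  Ψ-series≈ x n 2≤n k = begin
    Ψ-series x n k
      ≈⟨ ∑∣-cong n (λ d → trans (quotient≈ x d (fromℤ (μ d)) k) (+-congˡ (*-comm _ _))) ⟩
    ∑∣ n (λ d → (E′ *ₛ B d) k + E k * fromℤ (μ d))
      ≈⟨ ∑∣-+ n (λ d → (E′ *ₛ B d) k) (λ d → E k * fromℤ (μ d)) ⟩
    ∑∣ n (λ d → (E′ *ₛ B d) k) + ∑∣ n (λ d → E k * fromℤ (μ d))
      ≈⟨ +-cong (sym (∑∣-*ₛ n E′ B k)) (∑∣-*ˡ n (E k) (λ d → fromℤ (μ d))) ⟩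
    (E′ *ₛ M-series n) k + E k * ∑∣ n (λ d → fromℤ (μ d))
      ≈⟨ +-congˡ (trans (*-congˡ (∑∣μ≈0 n 2≤n)) (zeroʳ _)) ⟩
    (E′ *ₛ M-series n) k + 0#
      ≈⟨ +-identityʳ _ ⟩
    (E′ *ₛ M-series n) k
      ≈⟨ *ₛ-comm E′ (M-series n) k ⟩
    (M-series n *ₛ E′) k ∎
    where
    open A-Reasoning
    E  = exp[ x t]-1
    E′ = shift E

    B : (d : ℕ) → .{{NonZero d}} → Series
    B d = (fromℤ (μ d) ·ₛ t) /exp[ d t]-1

  -- Comparison of coefficients

  -- Since K! = C(K, j) j! (K - j)!, the prefactor k! N! / K! times C(K, j) j! is k! N! / (K - j)!,
  -- and 1 / (K - j)! is the factorial inside the exponential coefficient.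
  coefficient≈ : ∀ k N j (m x : Carrier) → j ≤ k →
    let K = k ℕ.+ N ; s = S (K ∸ j) N in
    fromℕ (k !) * (m * (fromℕ (N ! ℕ.* s) * exp[ x t] (K ∸ j))) ≈
    ι (((+ (k ! ℕ.* N !)) ℚ./ (K !)) {{K !≢0}}) *
      (fromℕ (K C j) * (fromℕ (j !) * m) * fromℕ s * x ^ (K ∸ j))
  coefficient≈ k N j m x j≤k = begin
    κ * (m * (fromℕ (N ! ℕ.* s) * (X * l)))
      ≈⟨ *-congˡ (*-congˡ (*-congʳ (fromℕ-* (N !) s))) ⟩
    κ * (m * (ν * σ * (X * l)))
      ≈⟨ *-identityʳ _ ⟨
    κ * (m * (ν * σ * (X * l))) * 1#
      -- The inserted `1#` is K! / K! with the numerator expanded by the binomial coefficient. Its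
      -- factor `L` will cancel against `l`, and `q` becomes the denominator of the prefactor.
      ≈⟨ *-congˡ (trans (sym (*-1/ (K !) {{K !≢0}})) (*-congʳ K!≈)) ⟩
    κ * (m * (ν * σ * (X * l))) * (b * (j′ * L) * q)
      ≈⟨ solve 10 (λ κ m ν σ X l b j L q →
           κ :* (m :* (ν :* σ :* (X :* l))) :* (b :* (j :* L) :* q) :=
           κ :* ν :* q :* (b :* (j :* m) :* σ :* X) :* (L :* l)) refl κ m ν σ X l b j′ L q ⟩
    κ * ν * q * (b * (j′ * m) * σ * X) * (L * l)
      ≈⟨ trans (*-congˡ (*-1/ ((K ∸ j) !) {{(K ∸ j) !≢0}})) (*-identityʳ _) ⟩
    κ * ν * q * (b * (j′ * m) * σ * X)
      ≈⟨ *-congʳ (trans (ι-/ (k ! ℕ.* N !) (K !) {{K !≢0}}) (*-congʳ (fromℕ-* (k !) (N !)))) ⟨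
    ι (((+ (k ! ℕ.* N !)) ℚ./ (K !)) {{K !≢0}}) * (b * (j′ * m) * σ * X) ∎
    where
    open A-Reasoning
    K = k ℕ.+ N
    s = S (K ∸ j) N
    κ = fromℕ (k !)
    ν = fromℕ (N !)
    σ = fromℕ s
    X = x ^ (K ∸ j)
    l = 1/[ K ∸ j !]
    b = fromℕ (K C j)
    j′ = fromℕ (j !)
    L = fromℕ ((K ∸ j) !)
    q = 1/[ K !]

    K!≈ : fromℕ (K !) ≈ b * (j′ * L)
    K!≈ = begin
      fromℕ (K !)                                    ≡⟨ ≡.cong fromℕ (nCk*k!*[n∸k]!≡n! (ℕ.≤-trans j≤k (ℕ.m≤m+n k N))) ⟨
      fromℕ ((K C j) ℕ.* (j ! ℕ.* (K ∸ j) !))        ≈⟨ fromℕ-* (K C j) (j ! ℕ.* (K ∸ j) !) ⟩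
      b * fromℕ (j ! ℕ.* (K ∸ j) !)                  ≈⟨ *-congˡ (fromℕ-* (j !) ((K ∸ j) !)) ⟩
      b * (j′ * L)                                   ∎

theorem3p1 : {c ℓ : Level} (A : ℚ-Algebra c ℓ) →
    let open MöbiusBernoulli A in
    (N k n : ℕ) (x : Carrier) → 1 ≤ N → 2 ≤ n →
    Ψ^ N k x n ≈
    ι (((+ (k ! ℕ.* N !)) ℚ./ ((k ℕ.+ N) !)) {{(k ℕ.+ N) !≢0}}) *
    (∑[ j ≤ k ]
    (fromℕ ((k ℕ.+ N) C toℕ j) * M^ N (toℕ j) n
    * fromℕ (S (k ℕ.+ N ∸ toℕ j) N) * x ^ (k ℕ.+ N ∸ toℕ j)))
theorem3p1 A N k n x _ 2≤n = begin
  Ψ^ N k x n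
    ≈⟨ sumOfProducts-! N (Ψ-series x n) k ⟩
  fromℕ (k !) * (Ψ-series x n ^ₛ N) k
    ≈⟨ *-congˡ (trans (^ₛ-congˡ N {Ψ-series x n} {M-series n *ₛ E′} (Ψ-series≈ x n 2≤n) k)
         (^ₛ-distrib-*ₛ (M-series n) E′ N k)) ⟩
  fromℕ (k !) * (M-series n ^ₛ N *ₛ E′ ^ₛ N) k
    ≈⟨ *-distribˡ-sum {suc k} (fromℕ (k !)) (λ j → (M-series n ^ₛ N) (toℕ j) * (E′ ^ₛ N) (k ∸ toℕ j)) ⟩
  ∑[ j ≤ k ] (fromℕ (k !) * ((M-series n ^ₛ N) (toℕ j) * (E′ ^ₛ N) (k ∸ toℕ j)))
    ≈⟨ sum-cong-≋ {suc k} (λ j → summand (toℕ j) (ℕ.≤-pred (Fin.toℕ<n j))) ⟩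
  ∑[ j ≤ k ] (r * f (toℕ j))
    ≈⟨ *-distribˡ-sum {suc k} r (λ j → f (toℕ j)) ⟨
  r * ∑[ j ≤ k ] f (toℕ j) ∎
  where
  open MöbiusBernoulli A
  open PowerSeries A
  open Products A
  open A-Reasoning
  open Sum semiring
    using (sum-cong-≋; *-distribˡ-sum)

  E′ = shift exp[ x t]-1
  r  = ι (((+ (k ! ℕ.* N !)) ℚ./ ((k ℕ.+ N) !)) {{(k ℕ.+ N) !≢0}})

  f : ℕ → Carrier
  f j = fromℕ ((k ℕ.+ N) C j) * M^ N j n * fromℕ (S (k ℕ.+ N ∸ j) N) * x ^ (k ℕ.+ N ∸ j)

  summand : ∀ j → j ≤ k → fromℕ (k !) * ((M-series n ^ₛ N) j * (E′ ^ₛ N) (k ∸ j)) ≈ r * f j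
  summand j j≤k = begin
    fromℕ (k !) * ((M-series n ^ₛ N) j * (E′ ^ₛ N) (k ∸ j))
      ≈⟨ *-congˡ (*-congˡ (shift-[exp-1]^ x N (k ∸ j))) ⟩
    fromℕ (k !) * ((M-series n ^ₛ N) j * (exp[ x t]-1 ^ₛ N) (N ℕ.+ (k ∸ j)))
      ≡⟨ ≡.cong (λ l → fromℕ (k !) * ((M-series n ^ₛ N) j * (exp[ x t]-1 ^ₛ N) l)) N+[k∸j] ⟩
    fromℕ (k !) * ((M-series n ^ₛ N) j * (exp[ x t]-1 ^ₛ N) (k ℕ.+ N ∸ j))
      ≈⟨ *-congˡ (*-congˡ ([exp-1]^ x N (k ℕ.+ N ∸ j))) ⟩
    fromℕ (k !) * ((M-series n ^ₛ N) j * (fromℕ (N ! ℕ.* S (k ℕ.+ N ∸ j) N) * exp[ x t] (k ℕ.+ N ∸ j)))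
      ≈⟨ coefficient≈ k N j ((M-series n ^ₛ N) j) x j≤k ⟩
    r * (fromℕ ((k ℕ.+ N) C j) * (fromℕ (j !) * (M-series n ^ₛ N) j) * fromℕ (S (k ℕ.+ N ∸ j) N) * x ^ (k ℕ.+ N ∸ j))
      -- The factor `j !` coming from the binomial coefficient turns coefficient `j` of the N-th
      -- power into `M^ N j n`.
      ≈⟨ *-congˡ (*-congʳ (*-congʳ (*-congˡ (sumOfProducts-! N (M-series n) j)))) ⟨
    r * f j ∎
    where
    N+[k∸j] : N ℕ.+ (k ∸ j) ≡ k ℕ.+ N ∸ j
    -- Subtraction is truncated, so the reassociation relies on `j≤k`.
    N+[k∸j] = ≡.trans (≡.sym (ℕ.+-∸-assoc N j≤k)) (≡.cong (_∸ j) (ℕ.+-comm N k))
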